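{- Let $b \geq 3$ be an integer. Then $$\#\mathcal{N}_{b,0}(x) > x^{\rho_{b,0} + o(1)}, \quad \text{as } x \to +\infty,$$ where $$\rho_{b,0} := \sup_{\alpha_0,\dots,\alpha_{b-1}} \frac{\left(\sum_{d=0}^{b-1}\alpha_d\right)\log\left(\sum_{d=0}^{b-1}\alpha_d\right) - \sum_{d=0}^{b-1}\alpha_d\log\alpha_d}{\left(1 + \sum_{d=0}^{b-1}\alpha_d\right)\log b},$$ the supremum being taken over all real numbers $\alpha_0,\dots,\alpha_{b-1} \geq 0$ satisfying both of the following conditions: (i) for each $d \in \{2,\dots,b-1\}$, $\alpha_d = 0$ if there exists a prime $p$ with $p \mid d$ and $p \nmid b$; (ii) $\sum_{d=2}^{b-1}\alpha_d\,\nu_p(d) \leq 1$ for all primes $p \mid b$; and with the convention $0\cdot\log 0 := 0$.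
   Context: For an integer $b \geq 2$, every positive integer $n$ has a unique representation $n = \sum_{j=0}^{\ell} d_j b^j$ with $d_0,\dots,d_\ell \in \{0,\dots,b-1\}$ and $d_\ell \neq 0$; the $d_0,\dots,d_\ell$ are the base $b$ digits of $n$. Let $p_{b,0}(n)$ be the product of the nonzero base $b$ digits of $n$. For real $x \geq 1$, let $\mathcal{N}_{b,0}(x) := \{n \leq x : p_{b,0}(n) \mid n\}$, where $n$ ranges over positive integers. $\nu_p$ denotes the $p$-adic valuation and $\log$ is the natural logarithm. The notation $f(x) > x^{\rho + o(1)}$ as $x \to +\infty$ (with $b$ fixed) means that there is a function $\varepsilon(x)$ with $\varepsilon(x) \to 0$ as $x \to +\infty$ such that $f(x) > x^{\rho + \varepsilon(x)}$ for all sufficiently large $x$. -}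

module Defs where

open import Algebra.Bundles using (CommutativeRing; Semiring)
open import Algebra.Structures using (IsCommutativeRing)
import Algebra.Definitions.RawSemiring as SemiringDefinitions
open import Data.Bool.Base using (if_then_else_)
open import Data.Digit using (toDigits)
open import Data.Fin.Base using (Fin; toℕ)
open import Data.List.Base using (List; filter; length; map)
open import Data.List.Membership.Propositional using (_∈_)
open import Data.List.Relation.Unary.Unique.Propositional using (Unique)
open import Data.Nat.Base as ℕ using (ℕ; zero; suc)
open import Data.Nat.Divisibility using (_∣_; _∤_; _∣?_)
open import Data.Nat.ListAction using (product)
open import Data.Nat.Primality using (Prime)
import Data.Nat.Properties as ℕ
open import Data.Product.Base using (∃; _×_; proj₁)
open import Function.Bundles using (_⇔_)
open import Level using (0ℓ)
import Relation.Binary.Construct.NonStrictToStrict as ToStrict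
open import Relation.Binary.PropositionalEquality using (_≡_; _≢_)
open import Relation.Binary.Structures using (IsTotalOrder)
open import Relation.Nullary.Decidable using (does; fromWitness; ¬?)
open import Relation.Unary using (Pred; Satisfiable)

-- Any two Dedekind-complete ordered fields are isomorphic, so a statement
-- about all of them is a statement about the real numbers.  Inversion and
-- supremum are total operations, specified only on nonzero elements and on
-- nonempty sets bounded above, respectively.

record CompleteOrderedField : Set₁ where
  infixl 6 _+_
  infixl 7 _*_
  infix  8 -_
  infix  9 _⁻¹
  infix  4 _≤_

  field
    ℝ       : Set
    _+_ _*_ : ℝ → ℝ → ℝ
    -_ _⁻¹  : ℝ → ℝ
    0# 1#   : ℝ
    _≤_     : ℝ → ℝ → Set
    ⋁       : Pred ℝ 0ℓ → ℝ

  UpperBound : Pred ℝ 0ℓ → ℝ → Set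
  UpperBound S u = ∀ x → S x → x ≤ u

  field
    isCommutativeRing : IsCommutativeRing _≡_ _+_ _*_ -_ 0# 1#
    0≢1               : 0# ≢ 1#
    ⁻¹-inverseʳ       : ∀ x → x ≢ 0# → x * x ⁻¹ ≡ 1#
    isTotalOrder      : IsTotalOrder _≡_ _≤_
    +-monoʳ-≤         : ∀ x {y z} → y ≤ z → x + y ≤ x + z
    *-nonneg          : ∀ {x y} → 0# ≤ x → 0# ≤ y → 0# ≤ x * y
    ⋁-upper           : ∀ S → Satisfiable S → ∃ (UpperBound S) → UpperBound S (⋁ S)
    ⋁-least           : ∀ S → Satisfiable S → ∀ u → UpperBound S u → ⋁ S ≤ u

  commutativeRing : CommutativeRing 0ℓ 0ℓ
  commutativeRing = record { isCommutativeRing = isCommutativeRing }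

  open CommutativeRing commutativeRing public using (_-_; semiring)
  open ToStrict _≡_ _≤_ public using (_<_)
  open SemiringDefinitions (Semiring.rawSemiring semiring) public
    using (sum) renaming (_×_ to _·_; _^_ to _^ℕ_)

  infixl 7 _/_
  _/_ : ℝ → ℝ → ℝ
  x / y = x * y ⁻¹

  fromℕ : ℕ → ℝ
  fromℕ n = n · 1#

-- p_{b,0}.  Leading zeros in the digit list, if any, do not affect it.

nonzeroDigitProduct : (b : ℕ) → 2 ℕ.≤ b → ℕ → ℕ
nonzeroDigitProduct b 2≤b n =
  product (filter (λ d → ¬? (d ℕ.≟ 0)) (map toℕ (proj₁ (toDigits b {fromWitness 2≤b} n))))

greatestExponent≤ : ℕ → ℕ → ℕ → ℕ
greatestExponent≤ zero    p n = 0
greatestExponent≤ (suc k) p n =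
  if does ((p ℕ.^ suc k) ∣? n) then suc k else greatestExponent≤ k p n

-- If p ≥ 2, n ≥ 1 and p ^ k ∣ n then k < p ^ k ≤ n, so capping the exponent
-- at n loses nothing.  The value at n = 0 is junk.

ν : ℕ → ℕ → ℕ
ν p n = greatestExponent≤ n p n

_HasCardinality_ : Pred ℕ 0ℓ → ℕ → Set
S HasCardinality k =
  ∃ λ (xs : List ℕ) → Unique xs × length xs ≡ k × (∀ n → n ∈ xs ⇔ S n)

module RealAnalysis (F : CompleteOrderedField) where
  open CompleteOrderedField F public

  -- The limit inferior, hence the limit whenever the sequence converges.

  lim : (ℕ → ℝ) → ℝ
  lim a = ⋁ λ y → ∃ λ N → ∀ n → N ℕ.≤ n → y ≤ a n

  -- exp x = lim (1 + x / n) ^ n, indexed from n = 1.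

  exp : ℝ → ℝ
  exp x = lim λ n → (1# + x / fromℕ (suc n)) ^ℕ suc n

  -- The inverse of exp on the positive reals.  Elsewhere the value is junk.

  log : ℝ → ℝ
  log y = ⋁ λ x → exp x ≤ y

  -- Meaningful for positive base.

  infixr 8 _^_
  _^_ : ℝ → ℝ → ℝ
  x ^ y = exp (y * log x)

  Eventually : Pred ℝ 0ℓ → Set
  Eventually P = ∃ λ x₀ → ∀ x → x₀ ≤ x → P x

  _⟶0 : (ℝ → ℝ) → Set
  ε ⟶0 = ∀ δ → 0# < δ → Eventually λ x → - δ < ε x × ε x < δ

  𝒩 : (b : ℕ) → 2 ℕ.≤ b → ℝ → Pred ℕ 0ℓ
  𝒩 b 2≤b x n = 1 ℕ.≤ n × fromℕ n ≤ x × nonzeroDigitProduct b 2≤b n ∣ n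

  record Admissible (b : ℕ) (α : Fin b → ℝ) : Set where
    field
      nonneg    : ∀ d → 0# ≤ α d
      vanishing : ∀ d → 2 ℕ.≤ toℕ d →
                  (∃ λ p → Prime p × p ∣ toℕ d × p ∤ b) → α d ≡ 0#
      valuation : ∀ p → Prime p → p ∣ b →
                  sum (λ d → if does (2 ℕ.≤? toℕ d)
                             then α d * fromℕ (ν p (toℕ d))
                             else 0#) ≤ 1#

  -- The convention 0 log 0 = 0 holds because 0# is absorbing, whatever the
  -- junk value of log 0#.

  xlogx : ℝ → ℝ
  xlogx x = x * log x

  exponent : (b : ℕ) → (Fin b → ℝ) → ℝ
  exponent b α =
    (xlogx (sum α) - sum (λ d → xlogx (α d))) / ((1# + sum α) * log (fromℕ b))

  ρ : ℕ → ℝ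
  ρ b = ⋁ λ r → ∃ λ (α : Fin b → ℝ) → Admissible b α × r ≡ exponent b α

{-# OPTIONS --safe #-}
module Submission where

-- Fix an admissible α and a large s, and let c d = ⌊ s α d ⌋.  Consider the
-- numbers whose base b expansion is a leading 1, then a word in which each digit
-- d occurs c d times, then s zeros.  The nonzero digits multiply to ∏ d ^ c d,
-- whose prime divisors p all divide b and have multiplicity Σ c d ν p d ≤ s, so
-- the product divides b ^ s and hence the number.  These numbers lie below
-- b ^ (s (1 + Σ α) + 1), and there are (Σ c)! / ∏ (c d)! of them.  By
-- log n! = n log n - n + O(log n) this multinomial coefficient is at least
-- exp (s H - O(log s)), where H is the numerator of the exponent of α.  Taking s
-- maximal for a given x yields more than x ^ r numbers for every r below the
-- exponent of α, and such r come arbitrarily close to ρ b.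

-- The field is known only through its axioms, so `exp` and `log` must be built from their suprema.
-- Two inequalities carry this: convexity of powers, and `(1 + x/n) (1 - x/n) ≤ 1`. They lead to
-- `1 + d ≤ exp d`, on which all bounds for `log n!` rest. Crude bounds suffice: an error `O(log s)`
-- is beaten by the linear gap `(R - r) q s`, where `R` is the exponent of α, `r < R` and
-- `q = (1 + Σ α) log b`. The counts are rounded down because `c d ≤ s α d` preserves both
-- admissibility conditions. The total shortfall is at most `b`, which costs only `O(log s)` in the
-- logarithm of the multinomial coefficient. The leading 1 leaves the digit product unchanged and
-- keeps the number positive even if the word is empty or consists of zeros. The main comparison
-- multiplies an upper bound for `log x` by `r`, so it covers only `r ≥ 0`. For `r < 0` it is enough
-- that 1 is counted.

open import Defs
import Algebra.Properties.CommutativeMonoid.Sum as MonoidSum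
import Algebra.Properties.CommutativeSemigroup as CommutativeSemigroupProperties
import Algebra.Properties.CommutativeSemiring.Exp as Exp
import Algebra.Properties.Ring as RingProperties
import Algebra.Properties.Semiring.Mult as Mult
import Algebra.Properties.Semiring.Mult.TCOptimised as Multiple
import Algebra.Properties.Semiring.Sum as SemiringSum
open import Algebra.Bundles using (CommutativeMonoid; CommutativeRing; Ring)
open import Axiom.ExcludedMiddle using (ExcludedMiddle)
open import Data.Bool.Base using (Bool; true; false; T; if_then_else_)
open import Data.Digit using (Expansion; fromDigits; toDigits)
open import Data.Fin.Base using (Fin; zero; suc; toℕ)
import Data.Fin.Properties as Fin
open import Data.Integer.Base as ℤ using (ℤ; -[1+_]) renaming (+_ to pos)
import Data.Integer.Properties as ℤ
open import Data.List.Base using (List; []; _∷_; _++_; concat; filter; length; map; tabulate; upTo)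
import Data.List.Properties as List
open import Data.List.Membership.Propositional using (_∈_)
import Data.List.Membership.Propositional.Properties as ∈
open import Data.List.Relation.Binary.Disjoint.Propositional using (Disjoint)
open import Data.List.Relation.Unary.All as All using (All; []; _∷_)
import Data.List.Relation.Unary.All.Properties as All
open import Data.List.Relation.Unary.AllPairs using ([]; _∷_)
import Data.List.Relation.Unary.AllPairs.Properties as AllPairs
open import Data.List.Relation.Unary.Any using (here; there)
open import Data.List.Relation.Unary.Unique.Propositional using (Unique)
import Data.List.Relation.Unary.Unique.Propositional.Properties as Unique
open import Data.Maybe.Base using (nothing)
open import Data.Nat.Base as ℕ using (ℕ; zero; suc)
open import Data.Nat.Divisibility using (_∣_; _∤_; _∣?_; divides; 1∣_; ∣-trans; ∣-refl; ∣-reflexive; *-cancelˡ-∣; *-monoʳ-∣; *-pres-∣; m∣m*n; ∣⇒≤; ∣n⇒∣m*n)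
open import Data.Nat.DivMod using (_%_; m<n⇒m%n≡m; [m+kn]%n≡m%n)
open import Data.Nat.ListAction using (product)
open import Data.Nat.Primality using (Prime; euclidsLemma; prime⇒irreducible; prime⇒nonTrivial; prime⇒nonZero)
open import Data.Nat.Primality.Factorisation using (PrimeFactorisation; factorise)
import Data.Nat.Properties as ℕ
open import Data.Product.Base using (∃; ∃₂; _×_; _,_; proj₁; proj₂)
open import Data.Sum.Base using (_⊎_; inj₁; inj₂)
open import Data.Vec.Functional using (updateAt)
import Data.Vec.Functional.Properties as Vector
open import Function.Base using (_∘_)
open import Function.Bundles using (Equivalence; mk⇔)
open import Level using (0ℓ)
open import Relation.Binary.Bundles using (Poset)
open import Relation.Binary.PropositionalEquality using (_≡_; _≢_; refl; sym; trans; cong; cong₂; subst; subst₂; setoid; module ≡-Reasoning)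
import Relation.Binary.Reasoning.PartialOrder as PosetReasoning
import Relation.Binary.Reflection as Reflection
open import Relation.Binary.Structures using (IsTotalOrder)
open import Relation.Nullary using (¬_; Dec; yes; no; contradiction; does)
open import Relation.Nullary.Decidable using (¬?)
open import Relation.Unary using (Pred; Satisfiable)
open import Tactic.RingSolver.Core.AlmostCommutativeRing using (AlmostCommutativeRing; fromCommutativeRing)
open import Tactic.RingSolver.Core.Expression using (Expr; Κ; Ι; _⊕_; _⊗_; _⊛_; ⊝_; module Eval)
import Tactic.RingSolver.Core.Polynomial.Base as Polynomial
import Tactic.RingSolver.Core.Polynomial.Homomorphism as PolynomialHomomorphism
open import Tactic.RingSolver.Core.Polynomial.Parameters using (Homomorphism)
import Tactic.RingSolver.Core.Polynomial.Semantics as PolynomialSemantics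

-- The library's ring solver takes its coefficients from the ring itself, where
-- 1 - 1 does not compute to 0; with coefficients in ℤ it does.

module IntegerRingSolver (F : CompleteOrderedField) where
  open CompleteOrderedField F
  open CommutativeRing commutativeRing
    using (ring; +-comm; +-identityˡ; +-identityʳ; -‿inverseʳ; +-commutativeSemigroup)
  open RingProperties ring
  open Multiple semiring using (×1-homo-*; ×-homo-+; 1+×) renaming (_×_ to _·′_)
  open import Algebra.Properties.CommutativeSemigroup +-commutativeSemigroup using (interchange)
  open ≡-Reasoning

  -- The optimised multiple `_·′_` sends 1 to `1#` itself rather than to `1# + 0#`, so `1-homo` is
  -- `refl` and the literal `:1` evaluates to `1#`.
  ⟦_⟧ᶜ : ℤ → ℝ
  ⟦ pos n ⟧ᶜ      = n ·′ 1#
  ⟦ -[1+ n ] ⟧ᶜ = - (suc n ·′ 1#)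

  ⟦⊖⟧ : ∀ m n → ⟦ m ℤ.⊖ n ⟧ᶜ ≡ m ·′ 1# - n ·′ 1#
  ⟦⊖⟧ m zero = begin
    m ·′ 1#        ≡⟨ +-identityʳ _ ⟨
    m ·′ 1# + 0#   ≡⟨ cong (λ y → m ·′ 1# + y) -0#≈0# ⟨
    m ·′ 1# - 0#   ∎
  ⟦⊖⟧ zero (suc n) = sym (+-identityˡ _)
  ⟦⊖⟧ (suc m) (suc n) = begin
    ⟦ suc m ℤ.⊖ suc n ⟧ᶜ                ≡⟨ cong ⟦_⟧ᶜ (ℤ.[1+m]⊖[1+n]≡m⊖n m n) ⟩
    ⟦ m ℤ.⊖ n ⟧ᶜ                        ≡⟨ ⟦⊖⟧ m n ⟩
    m ·′ 1# - n ·′ 1#                   ≡⟨ +-identityˡ _ ⟨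
    0# + (m ·′ 1# - n ·′ 1#)            ≡⟨ cong (λ y → y + (m ·′ 1# - n ·′ 1#)) (-‿inverseʳ 1#) ⟨
    (1# - 1#) + (m ·′ 1# - n ·′ 1#)     ≡⟨ interchange 1# (- 1#) _ _ ⟩
    (1# + m ·′ 1#) + (- 1# - n ·′ 1#)   ≡⟨ cong (λ y → 1# + m ·′ 1# + y) (-‿+-comm 1# _) ⟩
    (1# + m ·′ 1#) - (1# + n ·′ 1#)     ≡⟨ cong₂ _-_ (1+× m 1#) (1+× n 1#) ⟨
    suc m ·′ 1# - suc n ·′ 1#           ∎

  ⟦+⟧ : ∀ i j → ⟦ i ℤ.+ j ⟧ᶜ ≡ ⟦ i ⟧ᶜ + ⟦ j ⟧ᶜ
  ⟦+⟧ (pos m)    (pos n)    = ×-homo-+ 1# m n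
  ⟦+⟧ (pos m)    -[1+ n ] = ⟦⊖⟧ m (suc n)
  ⟦+⟧ -[1+ m ] (pos n)    = trans (⟦⊖⟧ n (suc m)) (+-comm _ _)
  ⟦+⟧ -[1+ m ] -[1+ n ] = begin
    - (suc (suc (m ℕ.+ n)) ·′ 1#)      ≡⟨ cong (λ k → - (k ·′ 1#)) (ℕ.+-suc (suc m) n) ⟨
    - ((suc m ℕ.+ suc n) ·′ 1#)        ≡⟨ cong -_ (×-homo-+ 1# (suc m) (suc n)) ⟩
    - (suc m ·′ 1# + suc n ·′ 1#)      ≡⟨ -‿+-comm _ _ ⟨
    - (suc m ·′ 1#) - (suc n ·′ 1#)    ∎

  ⟦-⟧ : ∀ i → ⟦ ℤ.- i ⟧ᶜ ≡ - ⟦ i ⟧ᶜ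
  ⟦-⟧ (pos zero)   = sym -0#≈0#
  ⟦-⟧ (pos (suc n))  = refl
  ⟦-⟧ -[1+ n ]   = sym (-‿involutive _)

  ⟦*⟧ : ∀ i j → ⟦ i ℤ.* j ⟧ᶜ ≡ ⟦ i ⟧ᶜ * ⟦ j ⟧ᶜ
  ⟦*⟧ (pos m) (pos n) = begin
    ⟦ pos m ℤ.* pos n ⟧ᶜ     ≡⟨ cong ⟦_⟧ᶜ (ℤ.pos-* m n) ⟨
    (m ℕ.* n) ·′ 1#      ≡⟨ ×1-homo-* m n ⟩
    m ·′ 1# * n ·′ 1#    ∎
  ⟦*⟧ (pos m) -[1+ n ] = begin
    ⟦ pos m ℤ.* (ℤ.- (pos (suc n))) ⟧ᶜ     ≡⟨ cong ⟦_⟧ᶜ (ℤ.neg-distribʳ-* (pos m) (pos (suc n))) ⟨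
    ⟦ ℤ.- (pos m ℤ.* pos (suc n)) ⟧ᶜ       ≡⟨ ⟦-⟧ (pos m ℤ.* pos (suc n)) ⟩
    - ⟦ pos m ℤ.* pos (suc n) ⟧ᶜ           ≡⟨ cong -_ (⟦*⟧ (pos m) (pos (suc n))) ⟩
    - (m ·′ 1# * suc n ·′ 1#)        ≡⟨ -‿distribʳ-* _ _ ⟩
    m ·′ 1# * - (suc n ·′ 1#)        ∎
  ⟦*⟧ -[1+ m ] (pos n) = begin
    ⟦ (ℤ.- (pos (suc m))) ℤ.* pos n ⟧ᶜ     ≡⟨ cong ⟦_⟧ᶜ (ℤ.neg-distribˡ-* (pos (suc m)) (pos n)) ⟨
    ⟦ ℤ.- (pos (suc m) ℤ.* pos n) ⟧ᶜ       ≡⟨ ⟦-⟧ (pos (suc m) ℤ.* pos n) ⟩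
    - ⟦ pos (suc m) ℤ.* pos n ⟧ᶜ           ≡⟨ cong -_ (⟦*⟧ (pos (suc m)) (pos n)) ⟩
    - (suc m ·′ 1# * n ·′ 1#)        ≡⟨ -‿distribˡ-* _ _ ⟩
    - (suc m ·′ 1#) * n ·′ 1#        ∎
  ⟦*⟧ -[1+ m ] -[1+ n ] = begin
    (suc m ℕ.* suc n) ·′ 1#            ≡⟨ ×1-homo-* (suc m) (suc n) ⟩
    suc m ·′ 1# * suc n ·′ 1#          ≡⟨ -‿involutive _ ⟨
    - - (suc m ·′ 1# * suc n ·′ 1#)    ≡⟨ cong -_ (-‿distribʳ-* _ _) ⟩
    - (suc m ·′ 1# * - (suc n ·′ 1#))  ≡⟨ -‿distribˡ-* _ _ ⟩
    - (suc m ·′ 1#) * - (suc n ·′ 1#)  ∎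

  isZero : ℤ → Bool
  isZero (pos zero)  = true
  isZero (pos (suc _)) = false
  isZero -[1+ _ ]  = false

  isZero-correct : ∀ i → T (isZero i) → 0# ≡ ⟦ i ⟧ᶜ
  isZero-correct (pos zero) _ = refl

  homomorphism : Homomorphism 0ℓ 0ℓ 0ℓ 0ℓ
  homomorphism = record
    { from = record { rawRing = Ring.rawRing ℤ.+-*-ring ; isZero = isZero }
    ; to = fromCommutativeRing commutativeRing (λ _ → nothing)
    ; morphism = record
      { ⟦_⟧    = ⟦_⟧ᶜ
      ; +-homo = ⟦+⟧
      ; *-homo = ⟦*⟧
      ; -‿homo = ⟦-⟧
      ; 0-homo = refl
      ; 1-homo = refl
      }
    ; Zero-C⟶Zero-R = isZero-correct
    }

  open Homomorphism homomorphism using (from; to)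
  open Polynomial from using (Poly; κ; ι; _⊞_; _⊠_; ⊟_; _⊡_)
  open PolynomialSemantics homomorphism using () renaming (⟦_⟧ to ⟦_⟧ₚ)
  open PolynomialHomomorphism homomorphism using (κ-hom; ι-hom; ⊞-hom; ⊠-hom; ⊟-hom; ⊡-hom)
  open Eval (AlmostCommutativeRing.rawRing to) ⟦_⟧ᶜ using (⟦_⟧)

  normalise : ∀ {n} → Expr ℤ n → Poly n
  normalise (Κ x)   = κ x
  normalise (Ι x)   = ι x
  normalise (x ⊕ y) = normalise x ⊞ normalise y
  normalise (x ⊗ y) = normalise x ⊠ normalise y
  normalise (⊝ x)   = ⊟ normalise x
  normalise (x ⊛ i) = normalise x ⊡ i

  normalise-correct : ∀ {n} (e : Expr ℤ n) ρ → ⟦ normalise e ⟧ₚ ρ ≡ ⟦ e ⟧ ρ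
  normalise-correct (Κ x)   ρ = κ-hom x ρ
  normalise-correct (Ι x)   ρ = ι-hom x ρ
  normalise-correct (x ⊕ y) ρ =
    trans (⊞-hom (normalise x) (normalise y) ρ) (cong₂ _+_ (normalise-correct x ρ) (normalise-correct y ρ))
  normalise-correct (x ⊗ y) ρ =
    trans (⊠-hom (normalise x) (normalise y) ρ) (cong₂ _*_ (normalise-correct x ρ) (normalise-correct y ρ))
  normalise-correct (⊝ x)   ρ = trans (⊟-hom (normalise x) ρ) (cong -_ (normalise-correct x ρ))
  normalise-correct (x ⊛ i) ρ =
    trans (⊡-hom (normalise x) i ρ) (cong (λ y → AlmostCommutativeRing._^_ to y i) (normalise-correct x ρ))

  open Reflection (setoid ℝ) Ι ⟦_⟧ (λ e → ⟦ normalise e ⟧ₚ) normalise-correct public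
    using (solve) renaming (_⊜_ to _:=_)

  infixl 6 _:+_ _:-_
  infixl 7 _:*_
  infix  8 :-_

  _:+_ _:*_ _:-_ : ∀ {n} → Expr ℤ n → Expr ℤ n → Expr ℤ n
  _:+_ = _⊕_
  _:*_ = _⊗_
  x :- y = x ⊕ ⊝ y

  :-_ : ∀ {n} → Expr ℤ n → Expr ℤ n
  :-_ = ⊝_

  :0 :1 : ∀ {n} → Expr ℤ n
  :0 = Κ (pos 0)
  :1 = Κ (pos 1)

-- Ordered field arithmetic and the Archimedean property

module OrderedField (em : ExcludedMiddle 0ℓ) (F : CompleteOrderedField) where
  open RealAnalysis F
  open IntegerRingSolver F public using (solve; _:=_; _:+_; _:*_; _:-_; :-_; :0; :1)
  open CommutativeRing commutativeRing public
    using (+-comm; +-identityˡ; +-identityʳ; *-comm; *-assoc; *-identityˡ; *-identityʳ; zeroˡ; zeroʳ)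
  open IsTotalOrder isTotalOrder public
    using (total) renaming (refl to ≤-refl; reflexive to ≤-reflexive; trans to ≤-trans; antisym to ≤-antisym)

  ≤-poset : Poset 0ℓ 0ℓ 0ℓ
  ≤-poset = record { isPartialOrder = IsTotalOrder.isPartialOrder isTotalOrder }

  module ≤-Reasoning = PosetReasoning ≤-poset

  <⇒≤ : ∀ {x y} → x < y → x ≤ y
  <⇒≤ = proj₁

  <⇒≢ : ∀ {x y} → x < y → x ≢ y
  <⇒≢ = proj₂

  <-≤-trans : ∀ {x y z} → x < y → y ≤ z → x < z
  <-≤-trans (x≤y , x≢y) y≤z = ≤-trans x≤y y≤z , λ { refl → x≢y (≤-antisym x≤y y≤z) }

  ≤-<-trans : ∀ {x y z} → x ≤ y → y < z → x < z
  ≤-<-trans x≤y (y≤z , y≢z) = ≤-trans x≤y y≤z , λ { refl → y≢z (≤-antisym y≤z x≤y) }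

  <⇒≱ : ∀ {x y} → x < y → ¬ (y ≤ x)
  <⇒≱ (x≤y , x≢y) y≤x = x≢y (≤-antisym x≤y y≤x)

  ≤-<-connex : ∀ x y → x ≤ y ⊎ y < x
  ≤-<-connex x y with em {x ≤ y}
  ... | yes x≤y = inj₁ x≤y
  ... | no  x≰y with total x y
  ...   | inj₁ x≤y = contradiction x≤y x≰y
  ...   | inj₂ y≤x = inj₂ (y≤x , λ { refl → x≰y ≤-refl })

  ≰⇒> : ∀ {x y} → ¬ (x ≤ y) → y < x
  ≰⇒> {x} {y} x≰y with ≤-<-connex x y
  ... | inj₁ x≤y = contradiction x≤y x≰y
  ... | inj₂ y<x = y<x

  ≮⇒≥ : ∀ {x y} → ¬ (x < y) → y ≤ x
  ≮⇒≥ {x} {y} x≮y with ≤-<-connex y x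
  ... | inj₁ y≤x = y≤x
  ... | inj₂ x<y = contradiction x<y x≮y

  Δ≥0 : ∀ {x y} → x ≤ y → 0# ≤ y - x
  Δ≥0 {x} {y} x≤y = subst₂ _≤_
    (solve 1 (λ x → :- x :+ x := :0) refl x)
    (solve 2 (λ x y → :- x :+ y := y :- x) refl x y)
    (+-monoʳ-≤ (- x) x≤y)

  -- The form in which most inequalities below are proved: `d` is a certificate assembled from
  -- nonnegative parts, and the ring solver checks that it is the difference of the two sides.
  ≤-by : ∀ {x y d} → 0# ≤ d → d ≡ y - x → x ≤ y
  ≤-by {x} {y} 0≤d refl = subst₂ _≤_
    (solve 1 (λ x → x :+ :0 := x) refl x)
    (solve 2 (λ x y → x :+ (y :- x) := y) refl x y)
    (+-monoʳ-≤ x 0≤d)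

  Δ>0 : ∀ {x y} → x < y → 0# < y - x
  Δ>0 {x} {y} (x≤y , x≢y) = Δ≥0 x≤y , λ 0≡y-x → x≢y (begin
    x            ≡⟨ +-identityʳ x ⟨
    x + 0#       ≡⟨ cong (_+_ x) 0≡y-x ⟩
    x + (y - x)  ≡⟨ solve 2 (λ x y → x :+ (y :- x) := y) refl x y ⟩
    y            ∎)
    where open ≡-Reasoning

  <-by : ∀ {x y d} → 0# < d → d ≡ y - x → x < y
  <-by {x} {y} (0≤d , 0≢d) d≡y-x = ≤-by 0≤d d≡y-x , λ { refl →
    0≢d (sym (trans d≡y-x (solve 1 (λ x → x :- x := :0) refl x))) }

  infixl 6 _⊹_ _⊹<_ _<⊹_
  infixl 7 _⊠_ _⊠<_

  -- These operators assemble certificates for `≤-by` and `<-by`; in the sums, `<` stands on the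
  -- side of the strictly positive summand.
  _⊹_ : ∀ {x y} → 0# ≤ x → 0# ≤ y → 0# ≤ x + y
  _⊹_ {x} {y} 0≤x 0≤y = ≤-trans 0≤x (≤-by 0≤y (solve 2 (λ x y → y := x :+ y :- x) refl x y))

  _⊠_ : ∀ {x y} → 0# ≤ x → 0# ≤ y → 0# ≤ x * y
  _⊠_ = *-nonneg

  _⊹<_ : ∀ {x y} → 0# ≤ x → 0# < y → 0# < x + y
  _⊹<_ {x} {y} 0≤x 0<y = ≤-<-trans 0≤x (<-by 0<y (solve 2 (λ x y → y := x :+ y :- x) refl x y))

  _<⊹_ : ∀ {x y} → 0# < x → 0# ≤ y → 0# < x + y
  _<⊹_ {x} {y} 0<x 0≤y = <-≤-trans 0<x (≤-by 0≤y (solve 2 (λ x y → y := x :+ y :- x) refl x y))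

  +-mono-≤ : ∀ {x y u v} → x ≤ y → u ≤ v → x + u ≤ y + v
  +-mono-≤ {x} {y} {u} {v} x≤y u≤v = ≤-by (Δ≥0 x≤y ⊹ Δ≥0 u≤v)
    (solve 4 (λ x y u v → y :- x :+ (v :- u) := y :+ v :- (x :+ u)) refl x y u v)

  *-monoˡ-≤ : ∀ {c x y} → 0# ≤ c → x ≤ y → c * x ≤ c * y
  *-monoˡ-≤ {c} {x} {y} 0≤c x≤y = ≤-by (0≤c ⊠ Δ≥0 x≤y)
    (solve 3 (λ c x y → c :* (y :- x) := c :* y :- c :* x) refl c x y)

  *-monoʳ-≤ : ∀ {c x y} → 0# ≤ c → x ≤ y → x * c ≤ y * c
  *-monoʳ-≤ {c} {x} {y} 0≤c x≤y = ≤-by (0≤c ⊠ Δ≥0 x≤y)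
    (solve 3 (λ c x y → c :* (y :- x) := y :* c :- x :* c) refl c x y)

  *-mono-≤ : ∀ {x y u v} → 0# ≤ y → 0# ≤ u → x ≤ y → u ≤ v → x * u ≤ y * v
  *-mono-≤ 0≤y 0≤u x≤y u≤v = ≤-trans (*-monoʳ-≤ 0≤u x≤y) (*-monoˡ-≤ 0≤y u≤v)

  0≤x² : ∀ x → 0# ≤ x * x
  0≤x² x with total 0# x
  ... | inj₁ 0≤x = 0≤x ⊠ 0≤x
  ... | inj₂ x≤0 = subst (0# ≤_) (solve 1 (λ x → (:0 :- x) :* (:0 :- x) := x :* x) refl x) (Δ≥0 x≤0 ⊠ Δ≥0 x≤0)

  0≤1 : 0# ≤ 1#
  0≤1 = subst (0# ≤_) (*-identityˡ 1#) (0≤x² 1#)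

  0<1 : 0# < 1#
  0<1 = 0≤1 , 0≢1

  >⇒≢0 : ∀ {x} → 0# < x → x ≢ 0#
  >⇒≢0 (_ , 0≢x) refl = 0≢x refl

  x*x⁻¹≡1 : ∀ {x} → 0# < x → x * x ⁻¹ ≡ 1#
  x*x⁻¹≡1 0<x = ⁻¹-inverseʳ _ (>⇒≢0 0<x)

  0<x⁻¹ : ∀ {x} → 0# < x → 0# < x ⁻¹
  0<x⁻¹ {x} 0<x = ≰⇒> λ x⁻¹≤0 → <⇒≱ 0<1 (≤-by (<⇒≤ 0<x ⊠ Δ≥0 x⁻¹≤0) (begin
    x * (0# - x ⁻¹)  ≡⟨ solve 2 (λ x y → x :* (:0 :- y) := :0 :- x :* y) refl x (x ⁻¹) ⟩
    0# - x * x ⁻¹    ≡⟨ cong (_-_ 0#) (x*x⁻¹≡1 0<x) ⟩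
    0# - 1#          ∎))
    where open ≡-Reasoning

  x⁻¹*[x*y]≡y : ∀ {x} y → 0# < x → x ⁻¹ * (x * y) ≡ y
  x⁻¹*[x*y]≡y {x} y 0<x = begin
    x ⁻¹ * (x * y)  ≡⟨ solve 3 (λ x i y → i :* (x :* y) := x :* i :* y) refl x (x ⁻¹) y ⟩
    x * x ⁻¹ * y    ≡⟨ cong (λ z → z * y) (x*x⁻¹≡1 0<x) ⟩
    1# * y          ≡⟨ *-identityˡ y ⟩
    y               ∎
    where open ≡-Reasoning

  *-cancelˡ-≤ : ∀ {c x y} → 0# < c → c * x ≤ c * y → x ≤ y
  *-cancelˡ-≤ {c} {x} {y} 0<c cx≤cy =
    subst₂ _≤_ (x⁻¹*[x*y]≡y x 0<c) (x⁻¹*[x*y]≡y y 0<c) (*-monoˡ-≤ (<⇒≤ (0<x⁻¹ 0<c)) cx≤cy)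

  *-cancelˡ-< : ∀ {c x y} → 0# < c → c * x < c * y → x < y
  *-cancelˡ-< 0<c (cx≤cy , cx≢cy) = *-cancelˡ-≤ 0<c cx≤cy , λ { refl → cx≢cy refl }

  *-monoˡ-< : ∀ {c x y} → 0# < c → x < y → c * x < c * y
  *-monoˡ-< 0<c x<y = ≰⇒> λ cy≤cx → <⇒≱ x<y (*-cancelˡ-≤ 0<c cy≤cx)

  _⊠<_ : ∀ {x y} → 0# < x → 0# < y → 0# < x * y
  _⊠<_ {x} {y} 0<x 0<y = subst (_< x * y) (zeroʳ x) (*-monoˡ-< 0<x 0<y)

  x*[y/x]≡y : ∀ {x} y → 0# < x → x * (y / x) ≡ y
  x*[y/x]≡y {x} y 0<x = trans (solve 3 (λ x i y → x :* (y :* i) := i :* (x :* y)) refl x (x ⁻¹) y) (x⁻¹*[x*y]≡y y 0<x)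

  ≤/ : ∀ {x y z} → 0# < x → x * z ≤ y → z ≤ y / x
  ≤/ {x} {y} {z} 0<x xz≤y = *-cancelˡ-≤ 0<x (≤-trans xz≤y (≤-reflexive (sym (x*[y/x]≡y y 0<x))))

  fromℕ-+ : ∀ m n → fromℕ (m ℕ.+ n) ≡ fromℕ m + fromℕ n
  fromℕ-+ = Mult.×-homo-+ semiring 1#

  fromℕ-* : ∀ m n → fromℕ (m ℕ.* n) ≡ fromℕ m * fromℕ n
  fromℕ-* = Mult.×1-homo-* semiring

  fromℕ-^ : ∀ m n → fromℕ (m ℕ.^ n) ≡ fromℕ m ^ℕ n
  fromℕ-^ m zero    = +-identityʳ 1#
  fromℕ-^ m (suc n) = trans (fromℕ-* m (m ℕ.^ n)) (cong (_*_ (fromℕ m)) (fromℕ-^ m n))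

  0≤fromℕ : ∀ n → 0# ≤ fromℕ n
  0≤fromℕ zero    = ≤-refl
  0≤fromℕ (suc n) = 0≤1 ⊹ 0≤fromℕ n

  0<fromℕ-suc : ∀ n → 0# < fromℕ (suc n)
  0<fromℕ-suc n = 0<1 <⊹ 0≤fromℕ n

  0<fromℕ : ∀ {n} → 0 ℕ.< n → 0# < fromℕ n
  0<fromℕ {suc n} _ = 0<fromℕ-suc n

  1≤fromℕ : ∀ {n} → 0 ℕ.< n → 1# ≤ fromℕ n
  1≤fromℕ {suc n} _ = ≤-by (0≤fromℕ n) (solve 1 (λ n → n := :1 :+ n :- :1) refl (fromℕ n))

  fromℕ-mono-≤ : ∀ {m n} → m ℕ.≤ n → fromℕ m ≤ fromℕ n
  fromℕ-mono-≤ {n = n} ℕ.z≤n = 0≤fromℕ n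
  fromℕ-mono-≤ (ℕ.s≤s m≤n)   = +-monoʳ-≤ 1# (fromℕ-mono-≤ m≤n)

  fromℕ-mono-< : ∀ {m n} → m ℕ.< n → fromℕ m < fromℕ n
  fromℕ-mono-< {m} {suc n} (ℕ.s≤s m≤n) = <-by (0<1 <⊹ Δ≥0 (fromℕ-mono-≤ m≤n))
    (solve 2 (λ m n → :1 :+ (n :- m) := :1 :+ n :- m) refl (fromℕ m) (fromℕ n))

  fromℕ-cancel-≤ : ∀ {m n} → fromℕ m ≤ fromℕ n → m ℕ.≤ n
  fromℕ-cancel-≤ m≤n = ℕ.≮⇒≥ λ n<m → <⇒≱ (fromℕ-mono-< n<m) m≤n

  fromℕ-cancel-< : ∀ {m n} → fromℕ m < fromℕ n → m ℕ.< n
  fromℕ-cancel-< m<n = ℕ.≰⇒> λ n≤m → <⇒≱ m<n (fromℕ-mono-≤ n≤m)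

  -- Otherwise the naturals are bounded and have a supremum. Since `suc n` lies below it for every
  -- `n`, the supremum minus 1 is a smaller upper bound.
  archimedean : ∀ x → ∃ λ n → x < fromℕ n
  archimedean x with em {∃ λ n → x < fromℕ n}
  ... | yes bound = bound
  ... | no  none  = contradiction (⋁-least S (0# , 0 , refl) (⋁ S - 1#) ub) (<⇒≱ (<-by 0<1
          (solve 1 (λ s → :1 := s :- (s :- :1)) refl (⋁ S))))
    where
    S : Pred ℝ 0ℓ
    S y = ∃ λ n → y ≡ fromℕ n
    ub : UpperBound S (⋁ S - 1#)
    ub _ (n , refl) = ≤-by
      (Δ≥0 (⋁-upper S (0# , 0 , refl) (x , λ { _ (m , refl) → ≮⇒≥ λ x<m → none (m , x<m) }) (fromℕ (suc n)) (suc n , refl)))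
      (solve 2 (λ s n → s :- (:1 :+ n) := s :- :1 :- n) refl (⋁ S) (fromℕ n))

  floor : ∀ {x} → 0# ≤ x → ∃ λ n → fromℕ n ≤ x × x < fromℕ (suc n)
  floor {x} 0≤x = descend (proj₁ (archimedean x)) (proj₂ (archimedean x))
    where
    descend : ∀ n → x < fromℕ n → ∃ λ n → fromℕ n ≤ x × x < fromℕ (suc n)
    descend zero    x<0 = contradiction 0≤x (<⇒≱ x<0)
    descend (suc n) x<n+1 with ≤-<-connex (fromℕ n) x
    ... | inj₁ n≤x = n , n≤x , x<n+1
    ... | inj₂ x<n = descend n x<n

  -- After division by `n + 1` the constant `c` becomes negligible: if `x` exceeded `y`, any large
  -- `n + 1` beyond `c / (x - y)` would violate the bound.
  ≤-byArchimedes : ∀ {x y} c (N : ℕ) → (∀ n → N ℕ.≤ n → fromℕ (suc n) * x ≤ fromℕ (suc n) * y + c) → x ≤ y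
  ≤-byArchimedes {x} {y} c N bound with ≤-<-connex x y
  ... | inj₁ x≤y = x≤y
  ... | inj₂ y<x with archimedean (c / (x - y))
  ...   | m , c/d<m = contradiction (bound (N ℕ.+ m) (ℕ.m≤m+n N m)) (<⇒≱ (<-by
            (Δ>0 (<-≤-trans (subst (_< (x - y) * fromℕ m) (x*[y/x]≡y c 0<d) (*-monoˡ-< 0<d c/d<m))
                            (*-monoˡ-≤ (<⇒≤ 0<d) (fromℕ-mono-≤ (ℕ.m≤n⇒m≤1+n (ℕ.m≤n+m m N))))))
            (solve 4 (λ x y n c → (x :- y) :* n :- c := n :* x :- (n :* y :+ c)) refl x y (fromℕ (suc (N ℕ.+ m))) c)))
    where
    0<d = Δ>0 y<x

-- Exponential and logarithm

module ExpLog (em : ExcludedMiddle 0ℓ) (F : CompleteOrderedField) where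
  open RealAnalysis F
  open OrderedField em F
  open Exp (CommutativeRing.commutativeSemiring commutativeRing) using (^-distrib-*)

  0≤^ℕ : ∀ {x} n → 0# ≤ x → 0# ≤ x ^ℕ n
  0≤^ℕ zero    0≤x = 0≤1
  0≤^ℕ (suc n) 0≤x = 0≤x ⊠ 0≤^ℕ n 0≤x

  0<^ℕ : ∀ {x} n → 0# < x → 0# < x ^ℕ n
  0<^ℕ zero    0<x = 0<1
  0<^ℕ (suc n) 0<x = 0<x ⊠< 0<^ℕ n 0<x

  ^ℕ-mono-≤ : ∀ {x y} n → 0# ≤ x → x ≤ y → x ^ℕ n ≤ y ^ℕ n
  ^ℕ-mono-≤ zero    0≤x x≤y = ≤-refl
  ^ℕ-mono-≤ (suc n) 0≤x x≤y = *-mono-≤ (≤-trans 0≤x x≤y) (0≤^ℕ n 0≤x) x≤y (^ℕ-mono-≤ n 0≤x x≤y)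

  1^ℕ : ∀ n → 1# ^ℕ n ≡ 1#
  1^ℕ zero    = refl
  1^ℕ (suc n) = trans (*-identityˡ _) (1^ℕ n)

  -- Convexity of the power `n + 1`: the left side is its tangent at `u`, evaluated at `v`; for
  -- `u = 1` this is Bernoulli's inequality. In the induction, `v` times the old tangent exceeds the
  -- new one by `(n + 1) u^n (v - u)²`.
  tangent-≤-power : ∀ {u v} n → 0# ≤ u → 0# ≤ v → u ^ℕ n * (u + fromℕ (suc n) * (v - u)) ≤ v ^ℕ suc n
  tangent-≤-power {u} {v} zero 0≤u 0≤v = ≤-reflexive
    (solve 2 (λ u v → :1 :* (u :+ (:1 :+ :0) :* (v :- u)) := v :* :1) refl u v)
  tangent-≤-power {u} {v} (suc n) 0≤u 0≤v = ≤-trans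
    (≤-by (0≤^ℕ n 0≤u ⊠ (0≤fromℕ (suc n) ⊠ 0≤x² (v - u)))
      (solve 4 (λ u v p n →
          p :* ((:1 :+ n) :* ((v :- u) :* (v :- u)))
          := v :* (p :* (u :+ (:1 :+ n) :* (v :- u))) :- u :* p :* (u :+ (:1 :+ (:1 :+ n)) :* (v :- u)))
        refl u v (u ^ℕ n) (fromℕ n)))
    (*-monoˡ-≤ 0≤v (tangent-≤-power n 0≤u 0≤v))

  e : ℝ → ℕ → ℝ
  e x n = (1# + x / fromℕ (suc n)) ^ℕ suc n

  N*[x/N]≡x : ∀ x n → fromℕ (suc n) * (x / fromℕ (suc n)) ≡ x
  N*[x/N]≡x x n = x*[y/x]≡y x (0<fromℕ-suc n)

  0≤base : ∀ {x} n → 0# ≤ fromℕ (suc n) + x → 0# ≤ 1# + x / fromℕ (suc n)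
  0≤base {x} n 0≤n+x = *-cancelˡ-≤ (0<fromℕ-suc n) (subst₂ _≤_
    (sym (zeroʳ _))
    (trans (cong (_+_ (fromℕ (suc n))) (sym (N*[x/N]≡x x n)))
      (solve 2 (λ n y → n :+ n :* y := n :* (:1 :+ y)) refl (fromℕ (suc n)) (x / fromℕ (suc n))))
    0≤n+x)

  0<base : ∀ {x} n → 0# < fromℕ (suc n) + x → 0# < 1# + x / fromℕ (suc n)
  0<base {x} n 0<n+x = *-cancelˡ-< (0<fromℕ-suc n) (subst₂ _<_
    (sym (zeroʳ _))
    (trans (cong (_+_ (fromℕ (suc n))) (sym (N*[x/N]≡x x n)))
      (solve 2 (λ n y → n :+ n :* y := n :* (:1 :+ y)) refl (fromℕ (suc n)) (x / fromℕ (suc n))))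
    0<n+x)

  -- For u = 1 + x/N and v = 1 + x/(N + 1), the tangent bound simplifies to u ^ N
  -- because (N + 1) (v - u) = 1 - u.
  e-step : ∀ {x} n → 0# ≤ fromℕ (suc n) + x → e x n ≤ e x (suc n)
  e-step {x} n 0≤n+x = subst (_≤ e x (suc n)) (begin
      u ^ℕ N * (u + fromℕ (suc N) * (v - u))
        ≡⟨ solve 4 (λ p N s t → p :* (:1 :+ s :+ (:1 :+ N) :* (:1 :+ t :- (:1 :+ s)))
             := p :* (:1 :+ ((:1 :+ N) :* t :- N :* s))) refl (u ^ℕ N) (fromℕ N) s t ⟩
      u ^ℕ N * (1# + (fromℕ (suc N) * t - fromℕ N * s))
        ≡⟨ cong₂ (λ y z → u ^ℕ N * (1# + (y - z))) (N*[x/N]≡x x N) (N*[x/N]≡x x n) ⟩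
      u ^ℕ N * (1# + (x - x))
        ≡⟨ solve 2 (λ p x → p :* (:1 :+ (x :- x)) := p) refl (u ^ℕ N) x ⟩
      u ^ℕ N ∎)
    (tangent-≤-power N (0≤base n 0≤n+x) (0≤base N (≤-trans 0≤n+x
      (≤-by 0≤1 (solve 2 (λ N x → :1 := :1 :+ N :+ x :- (N :+ x)) refl (fromℕ N) x)))))
    where
    open ≡-Reasoning
    N = suc n
    s = x / fromℕ N
    t = x / fromℕ (suc N)
    u = 1# + s
    v = 1# + t

  -- The range in which the base of `e x n` is positive, and so in which `e x` increases. For
  -- negative `x` earlier terms can alternate in sign.
  Large : ℝ → ℕ → Set
  Large x N = ∀ n → N ℕ.≤ n → 0# < fromℕ (suc n) + x

  large : ∀ x → ∃ (Large x)
  large x with archimedean (- x)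
  ... | N , -x<N = N , λ n N≤n → <-by (Δ>0 -x<N <⊹ Δ≥0 (fromℕ-mono-≤ (ℕ.m≤n⇒m≤1+n N≤n)))
    (solve 3 (λ N x n → N :- :- x :+ (n :- N) := n :+ x :- :0) refl (fromℕ N) x (fromℕ (suc n)))

  e-mono : ∀ {x m n} → Large x m → m ℕ.≤ n → e x m ≤ e x n
  e-mono {x} {m} {n} large-m m≤n = go (ℕ.≤⇒≤′ m≤n)
    where
    go : ∀ {n} → m ℕ.≤′ n → e x m ≤ e x n
    go (ℕ.≤′-reflexive refl) = ≤-refl
    go (ℕ.≤′-step {n} m≤′n)  = ≤-trans (go m≤′n) (e-step n (<⇒≤ (large-m _ (ℕ.≤′⇒≤ m≤′n))))

  large-≤ : ∀ {x m n} → Large x m → m ℕ.≤ n → Large x n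
  large-≤ large-m m≤n k n≤k = large-m k (ℕ.≤-trans m≤n n≤k)

  0<e : ∀ {x m n} → Large x m → m ℕ.≤ n → 0# < e x n
  0<e {n = n} large-m m≤n = 0<^ℕ (suc n) (0<base n (large-m n m≤n))

  -- At a common index the two bases multiply to `1 - (x / (n + 1))²`.
  e*e⁻≤1 : ∀ {x m k n} → Large x m → Large (- x) k → m ℕ.≤ n → k ℕ.≤ n → e x n * e (- x) n ≤ 1#
  e*e⁻≤1 {x} {m} {k} {n} large-m large-k m≤n k≤n = begin
    e x n * e (- x) n                           ≡⟨ ^-distrib-* _ _ (suc n) ⟨
    ((1# + x * i) * (1# + - x * i)) ^ℕ suc n    ≤⟨ ^ℕ-mono-≤ (suc n)
      (0≤base n (<⇒≤ (large-m n m≤n)) ⊠ 0≤base n (<⇒≤ (large-k n k≤n)))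
      (≤-by (0≤x² (x * i)) (solve 2 (λ x i → (x :* i) :* (x :* i)
         := :1 :- (:1 :+ x :* i) :* (:1 :+ :- x :* i)) refl x i)) ⟩
    1# ^ℕ suc n                                 ≡⟨ 1^ℕ (suc n) ⟩
    1#                                          ∎
    where
    open ≤-Reasoning
    i = fromℕ (suc n) ⁻¹

  e*e⁻≤1′ : ∀ {x m k n l} → Large x m → Large (- x) k → m ℕ.≤ n → k ℕ.≤ l → e x n * e (- x) l ≤ 1#
  e*e⁻≤1′ {n = n} {l} large-m large-k m≤n k≤l = ≤-trans
    (*-mono-≤ (<⇒≤ (0<e large-m (ℕ.≤-trans m≤n (ℕ.m≤m⊔n n l)))) (<⇒≤ (0<e large-k k≤l))
              (e-mono (large-≤ large-m m≤n) (ℕ.m≤m⊔n n l)) (e-mono (large-≤ large-k k≤l) (ℕ.m≤n⊔m n l)))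
    (e*e⁻≤1 large-m large-k (ℕ.≤-trans m≤n (ℕ.m≤m⊔n n l)) (ℕ.≤-trans k≤l (ℕ.m≤n⊔m n l)))

  -- By monotonicity `e x m` is an eventual lower bound, hence a member of the set whose supremum is
  -- `exp x`. That set is bounded by `e (- x) k ⁻¹`, because `e x n * e (- x) k ≤ 1`.
  e≤exp : ∀ {x m} → Large x m → e x m ≤ exp x
  e≤exp {x} {m} large-m =
    ⋁-upper _ (e x m , inS) (e (- x) k ⁻¹ , bounded) (e x m) inS
    where
    inS = m , λ n m≤n → e-mono large-m m≤n
    k = proj₁ (large (- x))
    large-k = proj₂ (large (- x))
    bounded : UpperBound (λ y → ∃ λ N → ∀ n → N ℕ.≤ n → y ≤ e x n) (e (- x) k ⁻¹)
    bounded y (N , below) = *-cancelˡ-≤ (0<e large-k ℕ.≤-refl) (begin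
      e (- x) k * y             ≤⟨ *-monoˡ-≤ (<⇒≤ (0<e large-k ℕ.≤-refl)) (below (N ℕ.⊔ m) (ℕ.m≤m⊔n N m)) ⟩
      e (- x) k * e x (N ℕ.⊔ m) ≡⟨ *-comm _ _ ⟩
      e x (N ℕ.⊔ m) * e (- x) k ≤⟨ e*e⁻≤1′ large-m large-k (ℕ.m≤n⊔m N m) ℕ.≤-refl ⟩
      1#                        ≡⟨ x*x⁻¹≡1 (0<e large-k ℕ.≤-refl) ⟨
      e (- x) k * e (- x) k ⁻¹  ∎)
      where open ≤-Reasoning

  exp-least : ∀ {x u} N → (∀ n → N ℕ.≤ n → e x n ≤ u) → exp x ≤ u
  exp-least {x} {u} N e≤u = ⋁-least _
    (e x (proj₁ (large x)) , proj₁ (large x) , λ n m≤n → e-mono (proj₂ (large x)) m≤n) u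
    λ { y (M , below) → ≤-trans (below (M ℕ.⊔ N) (ℕ.m≤m⊔n M N)) (e≤u (M ℕ.⊔ N) (ℕ.m≤n⊔m M N)) }

  0<exp : ∀ x → 0# < exp x
  0<exp x = <-≤-trans (0<e (proj₂ (large x)) ℕ.≤-refl) (e≤exp (proj₂ (large x)))

  exp-least-* : ∀ {c x u} → 0# < c → ∀ N → (∀ n → N ℕ.≤ n → c * e x n ≤ u) → c * exp x ≤ u
  exp-least-* {c} {x} {u} 0<c N ce≤u = ≤-trans
    (*-monoˡ-≤ (<⇒≤ 0<c) (exp-least N λ n N≤n → ≤/ 0<c (ce≤u n N≤n)))
    (≤-reflexive (x*[y/x]≡y u 0<c))

  -- For `≤`, pass to the supremum in one index and then in the other. For `≥`, Bernoulli gives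
  -- `(1 - (x/N)²)^N ≥ 1 - x²/N`; multiplied by `N`, the error is the constant `x²`, which
  -- `≤-byArchimedes` removes.
  exp*exp⁻≡1 : ∀ x → exp x * exp (- x) ≡ 1#
  exp*exp⁻≡1 x = ≤-antisym
    (exp-least-* (0<exp x) k λ l k≤l → ≤-trans (≤-reflexive (*-comm _ _))
      (exp-least-* (0<e large-k k≤l) m λ n m≤n → ≤-trans (≤-reflexive (*-comm _ _)) (e*e⁻≤1′ large-m large-k m≤n k≤l)))
    (≤-byArchimedes (x * x) (m ℕ.⊔ k) lower)
    where
    m = proj₁ (large x)
    k = proj₁ (large (- x))
    large-m = proj₂ (large x)
    large-k = proj₂ (large (- x))
    lower : ∀ n → m ℕ.⊔ k ℕ.≤ n → fromℕ (suc n) * 1# ≤ fromℕ (suc n) * (exp x * exp (- x)) + x * x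
    lower n m⊔k≤n = begin
      N * 1#
        ≡⟨ solve 3 (λ N x i → N :* :1 :=
             N :* (:1 :* (:1 :+ N :* ((:1 :+ x :* i) :* (:1 :+ :- x :* i) :- :1))) :+ N :* (x :* i) :* (N :* (x :* i))) refl N x i ⟩
      N * (1# * (1# + N * (v - 1#))) + N * (x * i) * (N * (x * i))
        ≡⟨ cong₂ (λ p y → N * (p * (1# + N * (v - 1#))) + y * y) (sym (1^ℕ n)) (N*[x/N]≡x x n) ⟩
      N * (1# ^ℕ n * (1# + N * (v - 1#))) + x * x
        ≤⟨ +-mono-≤ (*-monoˡ-≤ (0≤fromℕ (suc n)) (tangent-≤-power n 0≤1 0≤v)) ≤-refl ⟩
      N * v ^ℕ suc n + x * x
        ≡⟨ cong (λ p → N * p + x * x) (^-distrib-* _ _ (suc n)) ⟩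
      N * (e x n * e (- x) n) + x * x
        ≤⟨ +-mono-≤ (*-monoˡ-≤ (0≤fromℕ (suc n)) (*-mono-≤ (<⇒≤ (0<exp x)) (<⇒≤ (0<e large-k k≤n))
             (e≤exp (large-≤ large-m m≤n)) (e≤exp (large-≤ large-k k≤n)))) ≤-refl ⟩
      N * (exp x * exp (- x)) + x * x ∎
      where
      open ≤-Reasoning
      m≤n = ℕ.≤-trans (ℕ.m≤m⊔n m k) m⊔k≤n
      k≤n = ℕ.≤-trans (ℕ.m≤n⊔m m k) m⊔k≤n
      N = fromℕ (suc n)
      i = N ⁻¹
      v = (1# + x * i) * (1# + - x * i)
      0≤v : 0# ≤ v
      0≤v = 0≤base n (<⇒≤ (large-m n m≤n)) ⊠ 0≤base n (<⇒≤ (large-k n k≤n))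

  -- Factor by factor: `(1 + x/N) (1 + y/N)` exceeds `1 + (x + y)/N` by `x y / N²`.
  exp-+-≤ : ∀ {x y} → 0# ≤ x * y → exp (x + y) ≤ exp x * exp y
  exp-+-≤ {x} {y} 0≤xy = exp-least (l ℕ.⊔ (m ℕ.⊔ k)) bound
    where
    l = proj₁ (large (x + y))
    m = proj₁ (large x)
    k = proj₁ (large y)
    bound : ∀ n → l ℕ.⊔ (m ℕ.⊔ k) ℕ.≤ n → e (x + y) n ≤ exp x * exp y
    bound n ≤n = begin
      e (x + y) n
        ≤⟨ ^ℕ-mono-≤ (suc n) (0≤base n (<⇒≤ (proj₂ (large (x + y)) n (ℕ.≤-trans (ℕ.m≤m⊔n l _) ≤n))))
             (≤-by (0≤xy ⊠ 0≤x² i)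
               (solve 3 (λ x y i → x :* y :* (i :* i) := (:1 :+ x :* i) :* (:1 :+ y :* i) :- (:1 :+ (x :+ y) :* i)) refl x y i)) ⟩
      ((1# + x * i) * (1# + y * i)) ^ℕ suc n
        ≡⟨ ^-distrib-* _ _ (suc n) ⟩
      e x n * e y n
        ≤⟨ *-mono-≤ (<⇒≤ (0<exp x)) (<⇒≤ (0<e (proj₂ (large y)) k≤n))
             (e≤exp (large-≤ (proj₂ (large x)) m≤n)) (e≤exp (large-≤ (proj₂ (large y)) k≤n)) ⟩
      exp x * exp y ∎
      where
      open ≤-Reasoning
      i = fromℕ (suc n) ⁻¹
      m≤n = ℕ.≤-trans (ℕ.m≤m⊔n m k) (ℕ.≤-trans (ℕ.m≤n⊔m l _) ≤n)
      k≤n = ℕ.≤-trans (ℕ.m≤n⊔m m k) (ℕ.≤-trans (ℕ.m≤n⊔m l _) ≤n)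

  -- The reverse inequality is `exp-+-≤` at `- x` and `- y`, whose product is the same, turned
  -- around by means of `exp*exp⁻≡1`.
  exp-+-sameSign : ∀ {x y} → 0# ≤ x * y → exp (x + y) ≡ exp x * exp y
  exp-+-sameSign {x} {y} 0≤xy = ≤-antisym (exp-+-≤ 0≤xy) (*-cancelˡ-≤ (0<exp (- x) ⊠< 0<exp (- y)) (begin
    exp (- x) * exp (- y) * (exp x * exp y)
      ≡⟨ solve 4 (λ a b c d → a :* b :* (c :* d) := c :* a :* (d :* b)) refl (exp (- x)) (exp (- y)) (exp x) (exp y) ⟩
    exp x * exp (- x) * (exp y * exp (- y))
      ≡⟨ cong₂ _*_ (exp*exp⁻≡1 x) (exp*exp⁻≡1 y) ⟩
    1# * 1#
      ≡⟨ *-identityˡ 1# ⟩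
    1#
      ≡⟨ exp*exp⁻≡1 (x + y) ⟨
    exp (x + y) * exp (- (x + y))
      ≡⟨ cong (λ z → exp (x + y) * exp z) (solve 2 (λ x y → :- (x :+ y) := :- x :+ :- y) refl x y) ⟩
    exp (x + y) * exp (- x + - y)
      ≤⟨ *-monoˡ-≤ (<⇒≤ (0<exp (x + y))) (exp-+-≤ (subst (0# ≤_) (solve 2 (λ x y → x :* y := :- x :* :- y) refl x y) 0≤xy)) ⟩
    exp (x + y) * (exp (- x) * exp (- y))
      ≡⟨ *-comm _ _ ⟩
    exp (- x) * exp (- y) * exp (x + y) ∎))
    where open ≤-Reasoning

  -- Here `x` is the sum of `x + y` and `- y`, which have the same sign.
  exp-+-oppositeSign : ∀ {x y} → 0# ≤ (x + y) * - y → exp (x + y) ≡ exp x * exp y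
  exp-+-oppositeSign {x} {y} 0≤ = begin
    exp (x + y)                               ≡⟨ *-identityʳ _ ⟨
    exp (x + y) * 1#                          ≡⟨ cong (_*_ (exp (x + y))) (exp*exp⁻≡1 y) ⟨
    exp (x + y) * (exp y * exp (- y))         ≡⟨ solve 3 (λ a b c → a :* (b :* c) := a :* c :* b) refl (exp (x + y)) (exp y) (exp (- y)) ⟩
    exp (x + y) * exp (- y) * exp y           ≡⟨ cong (λ z → z * exp y) (exp-+-sameSign 0≤) ⟨
    exp (x + y + - y) * exp y                 ≡⟨ cong (λ z → exp z * exp y) (solve 2 (λ x y → x :+ y :+ :- y := x) refl x y) ⟩
    exp x * exp y                             ∎
    where open ≡-Reasoning

  exp-+ : ∀ x y → exp (x + y) ≡ exp x * exp y
  exp-+ x y with ≤-<-connex 0# (x * y) | ≤-<-connex 0# ((x + y) * - y) | ≤-<-connex 0# ((y + x) * - x)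
  ... | inj₁ 0≤xy | _      | _      = exp-+-sameSign 0≤xy
  ... | inj₂ _    | inj₁ p | _      = exp-+-oppositeSign p
  ... | inj₂ _    | inj₂ _ | inj₁ q = trans (cong exp (+-comm x y)) (trans (exp-+-oppositeSign q) (*-comm _ _))
  -- The two negative products multiply to `(x + y)² x y`, which would be positive although `x y` is
  -- negative.
  ... | inj₂ xy<0 | inj₂ p | inj₂ q = contradiction
          (≤-by (0≤x² (x + y) ⊠ Δ≥0 (<⇒≤ xy<0))
            (solve 2 (λ x y → (x :+ y) :* (x :+ y) :* (:0 :- x :* y)
                := :0 :- (:0 :- (x :+ y) :* :- y) :* (:0 :- (y :+ x) :* :- x)) refl x y))
          (<⇒≱ (Δ>0 p ⊠< Δ>0 q))

  exp0≡1 : exp 0# ≡ 1#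
  exp0≡1 = ≤-antisym (exp-least 0 λ n _ → ≤-reflexive (e0≡1 n))
                     (≤-trans (≤-reflexive (sym (e0≡1 (proj₁ (large 0#))))) (e≤exp (proj₂ (large 0#))))
    where
    e0≡1 : ∀ n → e 0# n ≡ 1#
    e0≡1 n = trans (cong (_^ℕ suc n) (solve 1 (λ i → :1 :+ :0 :* i := :1) refl (fromℕ (suc n) ⁻¹))) (1^ℕ (suc n))

  -- When positive, `1 + x` is the term of index 0 and the sequence increases from there on.
  1+x≤exp : ∀ x → 1# + x ≤ exp x
  1+x≤exp x with ≤-<-connex (1# + x) 0#
  ... | inj₁ 1+x≤0 = ≤-trans 1+x≤0 (<⇒≤ (0<exp x))
  ... | inj₂ 0<1+x = begin
      1# + x                                      ≡⟨ cong (_+_ 1#) (N*[x/N]≡x x 0) ⟨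
      1# + fromℕ 1 * (x / fromℕ 1)                ≡⟨ solve 1 (λ y → :1 :+ (:1 :+ :0) :* y := (:1 :+ y) :* :1) refl (x / fromℕ 1) ⟩
      e x 0                                       ≤⟨ e≤exp {m = 0} (λ n _ → <-by (0<1+x <⊹ 0≤fromℕ n)
        (solve 2 (λ x n → :1 :+ x :+ n := :1 :+ n :+ x :- :0) refl x (fromℕ n))) ⟩
      exp x                                       ∎
    where open ≤-Reasoning

  exp-mono-< : ∀ {x y} → x < y → exp x < exp y
  exp-mono-< {x} {y} x<y = begin-strict
    exp x                    ≡⟨ *-identityʳ _ ⟨
    exp x * 1#               <⟨ *-monoˡ-< (0<exp x) (<-≤-trans (<-by (Δ>0 x<y)
      (solve 2 (λ x y → y :- x := :1 :+ (y :- x) :- :1) refl x y)) (1+x≤exp (y - x))) ⟩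
    exp x * exp (y - x)      ≡⟨ exp-+ x (y - x) ⟨
    exp (x + (y - x))        ≡⟨ cong exp (solve 2 (λ x y → x :+ (y :- x) := y) refl x y) ⟩
    exp y                    ∎
    where open ≤-Reasoning

  exp-mono-≤ : ∀ {x y} → x ≤ y → exp x ≤ exp y
  exp-mono-≤ {x} {y} x≤y with ≤-<-connex y x
  ... | inj₁ y≤x = ≤-reflexive (cong exp (≤-antisym x≤y y≤x))
  ... | inj₂ x<y = <⇒≤ (exp-mono-< x<y)

  exp-cancel-≤ : ∀ {x y} → exp x ≤ exp y → x ≤ y
  exp-cancel-≤ ex≤ey = ≮⇒≥ λ y<x → <⇒≱ (exp-mono-< y<x) ex≤ey

  exp-cancel-< : ∀ {x y} → exp x < exp y → x < y
  exp-cancel-< ex<ey = ≰⇒> λ y≤x → <⇒≱ ex<ey (exp-mono-≤ y≤x)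

  exp-injective : ∀ {x y} → exp x ≡ exp y → x ≡ y
  exp-injective eq = ≤-antisym (exp-cancel-≤ (≤-reflexive eq)) (exp-cancel-≤ (≤-reflexive (sym eq)))

  1-x≤exp⁻ : ∀ x → 1# - x ≤ exp (- x)
  1-x≤exp⁻ x = 1+x≤exp (- x)

  exp⁻≤ : ∀ {x y} → 1# ≤ y * exp x → exp (- x) ≤ y
  exp⁻≤ {x} {y} 1≤y*eˣ = *-cancelˡ-≤ (0<exp x)
    (≤-trans (≤-reflexive (exp*exp⁻≡1 x)) (≤-trans 1≤y*eˣ (≤-reflexive (*-comm _ _))))

  -- In place of continuity of `exp`, the inequality `1 - h ≤ exp (- h)` turns a gap between `exp l`
  -- and `y` into an explicit step `h` in the exponent. A step down would contradict that `l` is the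
  -- least upper bound, a step up that it is an upper bound.
  exp-log : ∀ {y} → 0# < y → exp (log y) ≡ y
  exp-log {y} 0<y = ≤-antisym (≮⇒≥ too-big) (≮⇒≥ too-small)
    where
    S : Pred ℝ 0ℓ
    S x = exp x ≤ y
    l = log y
    inhabited : Satisfiable S
    -- The witness works because `y * exp (1 / y) ≥ y * (1 + 1 / y) = y + 1 ≥ 1`.
    inhabited = - (y ⁻¹) , exp⁻≤ (≤-trans
      (≤-by (<⇒≤ 0<y) (trans (solve 2 (λ y z → y := z :+ y :- z) refl y 1#)
        (trans (cong (λ z → z + y - 1#) (sym (x*x⁻¹≡1 0<y)))
          (solve 2 (λ y i → y :* i :+ y :- :1 := y :* (:1 :+ i) :- :1) refl y (y ⁻¹)))))
      (*-monoˡ-≤ (<⇒≤ 0<y) (1+x≤exp (y ⁻¹))))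
    bounded : UpperBound S y
    bounded x eˣ≤y = ≤-trans (≤-by 0≤1 (solve 1 (λ x → :1 := :1 :+ x :- x) refl x)) (≤-trans (1+x≤exp x) eˣ≤y)

    -- The step h is chosen with y = exp l * (1 - h).
    too-big : ¬ (y < exp l)
    too-big y<eˡ = <⇒≱ (<-by 0<h (solve 2 (λ l h → h := l :- (l :- h)) refl l h))
      (⋁-least S inhabited (l - h) λ x eˣ≤y → exp-cancel-≤ (begin
        exp x               ≤⟨ eˣ≤y ⟩
        y                   ≡⟨ solve 2 (λ l y → y := l :- (l :- y)) refl (exp l) y ⟩
        exp l - (exp l - y) ≡⟨ cong (λ z → exp l - z) (x*[y/x]≡y (exp l - y) (0<exp l)) ⟨
        exp l - exp l * h   ≡⟨ solve 2 (λ l h → l :- l :* h := l :* (:1 :- h)) refl (exp l) h ⟩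
        exp l * (1# - h)    ≤⟨ *-monoˡ-≤ (<⇒≤ (0<exp l)) (1-x≤exp⁻ h) ⟩
        exp l * exp (- h)   ≡⟨ exp-+ l (- h) ⟨
        exp (l - h)         ∎))
      where
      open ≤-Reasoning
      h = (exp l - y) / exp l
      0<h : 0# < h
      0<h = Δ>0 y<eˡ ⊠< 0<x⁻¹ (0<exp l)

    -- Here h is chosen with exp l = y * (1 - h).
    too-small : ¬ (exp l < y)
    too-small eˡ<y = <⇒≱ (<-by 0<h (solve 2 (λ l h → h := l :+ h :- l) refl l h))
      (⋁-upper S inhabited (y , bounded) (l + h) (*-cancelˡ-≤ (0<exp (- h)) (begin
        exp (- h) * exp (l + h) ≡⟨ exp-+ (- h) (l + h) ⟨
        exp (- h + (l + h))     ≡⟨ cong exp (solve 2 (λ l h → :- h :+ (l :+ h) := l) refl l h) ⟩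
        exp l                   ≡⟨ solve 2 (λ l y → l := y :- (y :- l)) refl (exp l) y ⟩
        y - (y - exp l)         ≡⟨ cong (λ z → y - z) (x*[y/x]≡y (y - exp l) 0<y) ⟨
        y - y * h               ≡⟨ solve 2 (λ y h → y :- y :* h := (:1 :- h) :* y) refl y h ⟩
        (1# - h) * y            ≤⟨ *-monoʳ-≤ (<⇒≤ 0<y) (1-x≤exp⁻ h) ⟩
        exp (- h) * y           ∎)))
      where
      open ≤-Reasoning
      h = (y - exp l) / y
      0<h : 0# < h
      0<h = Δ>0 eˡ<y ⊠< 0<x⁻¹ 0<y

  log-mono-≤ : ∀ {x y} → 0# < x → x ≤ y → log x ≤ log y
  log-mono-≤ 0<x x≤y = exp-cancel-≤ (subst₂ _≤_ (sym (exp-log 0<x)) (sym (exp-log (<-≤-trans 0<x x≤y))) x≤y)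

  log-* : ∀ {x y} → 0# < x → 0# < y → log (x * y) ≡ log x + log y
  log-* {x} {y} 0<x 0<y = exp-injective (begin
    exp (log (x * y))          ≡⟨ exp-log (0<x ⊠< 0<y) ⟩
    x * y                      ≡⟨ cong₂ _*_ (exp-log 0<x) (exp-log 0<y) ⟨
    exp (log x) * exp (log y)  ≡⟨ exp-+ (log x) (log y) ⟨
    exp (log x + log y)        ∎)
    where open ≡-Reasoning

  log1≡0 : log 1# ≡ 0#
  log1≡0 = exp-injective (trans (exp-log 0<1) (sym exp0≡1))

  0≤log : ∀ {x} → 1# ≤ x → 0# ≤ log x
  0≤log 1≤x = ≤-trans (≤-reflexive (sym log1≡0)) (log-mono-≤ 0<1 1≤x)

  0<log : ∀ {x} → 1# < x → 0# < log x
  0<log 1<x = exp-cancel-< (subst₂ _<_ (sym exp0≡1) (sym (exp-log (≤-<-trans 0≤1 1<x))) 1<x)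

  log-^ℕ : ∀ {x} n → 0# < x → log (x ^ℕ n) ≡ fromℕ n * log x
  log-^ℕ {x} zero    0<x = trans log1≡0 (sym (zeroˡ (log x)))
  log-^ℕ {x} (suc n) 0<x = begin
    log (x * x ^ℕ n)           ≡⟨ log-* 0<x (0<^ℕ n 0<x) ⟩
    log x + log (x ^ℕ n)       ≡⟨ cong (_+_ (log x)) (log-^ℕ n 0<x) ⟩
    log x + fromℕ n * log x    ≡⟨ solve 2 (λ l n → l :+ n :* l := (:1 :+ n) :* l) refl (log x) (fromℕ n) ⟩
    fromℕ (suc n) * log x      ∎
    where open ≡-Reasoning

  -- This is `1 + d ≤ exp d` at `d = log (v / u)`, multiplied by `u`: the concavity of `log` that
  -- drives every estimate of `log!` below.
  log-tangent : ∀ {u v} → 0# < u → 0# < v → u * (log v - log u) ≤ v - u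
  log-tangent {u} {v} 0<u 0<v = ≤-by (<⇒≤ 0<u ⊠ Δ≥0 (1+x≤exp (log v - log u))) (begin
    u * (exp d - (1# + d))            ≡⟨ solve 3 (λ u E d → u :* (E :- (:1 :+ d)) := u :* E :- u :- u :* d) refl u (exp d) d ⟩
    u * exp d - u - u * d             ≡⟨ cong (λ z → z * exp d - u - u * d) (exp-log 0<u) ⟨
    exp (log u) * exp d - u - u * d   ≡⟨ cong (λ z → z - u - u * d) (exp-+ (log u) d) ⟨
    exp (log u + d) - u - u * d       ≡⟨ cong (λ z → exp z - u - u * d) (solve 2 (λ u v → u :+ (v :- u) := v) refl (log u) (log v)) ⟩
    exp (log v) - u - u * d           ≡⟨ cong (λ z → z - u - u * d) (exp-log 0<v) ⟩
    v - u - u * d                     ∎)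
    where
    open ≡-Reasoning
    d = log v - log u

-- Bounds for log n! and for x log x

module Factorials (em : ExcludedMiddle 0ℓ) (F : CompleteOrderedField) where
  open RealAnalysis F
  open OrderedField em F
  open ExpLog em F

  log! : ℕ → ℝ
  log! n = log (fromℕ (n ℕ.!))

  0<fromℕ! : ∀ n → 0# < fromℕ (n ℕ.!)
  0<fromℕ! n = 0<fromℕ (ℕ.1≤n! n)

  log!-suc : ∀ n → log! (suc n) ≡ log (fromℕ (suc n)) + log! n
  log!-suc n = trans (cong log (fromℕ-* (suc n) (n ℕ.!))) (log-* (0<fromℕ-suc n) (0<fromℕ! n))

  log!0≡0 : log! 0 ≡ 0#
  log!0≡0 = trans (cong log (+-identityʳ 1#)) log1≡0

  -- The right side is the integral of `log` from 1 to `n + 1`. The induction step is the tangent at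
  -- `n + 2`, evaluated at `n + 1`.
  log!-≤ : ∀ n → log! n ≤ fromℕ (suc n) * log (fromℕ (suc n)) - fromℕ n
  log!-≤ zero = begin
    log! 0                           ≡⟨ log!0≡0 ⟩
    0#                               ≤⟨ 0≤fromℕ 1 ⊠ 0≤log (1≤fromℕ {1} (ℕ.s≤s ℕ.z≤n)) ⟩
    fromℕ 1 * log (fromℕ 1)          ≡⟨ solve 1 (λ x → x := x :- :0) refl _ ⟩
    fromℕ 1 * log (fromℕ 1) - 0#     ∎
    where open ≤-Reasoning
  log!-≤ (suc n) = begin
    log! (suc n)                    ≡⟨ log!-suc n ⟩
    log (fromℕ (suc n)) + log! n    ≤⟨ +-mono-≤ ≤-refl (log!-≤ n) ⟩
    log (fromℕ (suc n)) + (fromℕ (suc n) * log (fromℕ (suc n)) - fromℕ n)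
      ≤⟨ ≤-by (Δ≥0 (log-tangent (0<fromℕ-suc (suc n)) (0<fromℕ-suc n)))
           (solve 3 (λ n l l′ → :1 :+ n :- (:1 :+ (:1 :+ n)) :- (:1 :+ (:1 :+ n)) :* (l :- l′)
              := (:1 :+ (:1 :+ n)) :* l′ :- (:1 :+ n) :- (l :+ ((:1 :+ n) :* l :- n)))
            refl (fromℕ n) (log (fromℕ (suc n))) (log (fromℕ (suc (suc n))))) ⟩
    fromℕ (suc (suc n)) * log (fromℕ (suc (suc n))) - fromℕ (suc n)  ∎
    where open ≤-Reasoning

  -- The product of `(1 + 1/k)^k` over `k = 1, ..., n` is `(n + 1)^n / n!`, and each factor is at
  -- most `exp 1`.
  log!-≥ : ∀ n → fromℕ n * log (fromℕ (suc n)) - fromℕ n ≤ log! n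
  log!-≥ zero = ≤-reflexive (trans (solve 1 (λ x → :0 :* x :- :0 := :0) refl (log (fromℕ 1))) (sym log!0≡0))
  log!-≥ (suc n) = begin
    fromℕ (suc n) * log (fromℕ (suc (suc n))) - fromℕ (suc n)
      ≤⟨ ≤-by (Δ≥0 (log-tangent (0<fromℕ-suc n) (0<fromℕ-suc (suc n))))
           (solve 3 (λ n l l′ → :1 :+ (:1 :+ n) :- (:1 :+ n) :- (:1 :+ n) :* (l′ :- l)
              := l :+ (n :* l :- n) :- ((:1 :+ n) :* l′ :- (:1 :+ n)))
            refl (fromℕ n) (log (fromℕ (suc n))) (log (fromℕ (suc (suc n))))) ⟩
    log (fromℕ (suc n)) + (fromℕ n * log (fromℕ (suc n)) - fromℕ n)  ≤⟨ +-mono-≤ ≤-refl (log!-≥ n) ⟩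
    log (fromℕ (suc n)) + log! n                                     ≡⟨ log!-suc n ⟨
    log! (suc n)                                                     ∎
    where open ≤-Reasoning

  -- In other words `t^n / n! ≤ exp t`. The free `t` allows an expansion around a real number near
  -- `n` instead of `n` itself.
  n*log[t]-t≤log! : ∀ n {t} → 0# < t → fromℕ n * log t - t ≤ log! n
  n*log[t]-t≤log! zero {t} 0<t = ≤-trans
    (≤-by (<⇒≤ 0<t) (solve 2 (λ t l → t := :0 :- (:0 :* l :- t)) refl t (log t)))
    (≤-reflexive (sym log!0≡0))
  n*log[t]-t≤log! n@(suc m) {t} 0<t = ≤-trans
    (≤-by (Δ≥0 (log-tangent (0<fromℕ-suc m) 0<t)
            ⊹ 0≤fromℕ n ⊠ Δ≥0 (log-mono-≤ (0<fromℕ-suc m) (fromℕ-mono-≤ (ℕ.n≤1+n n))))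
      (solve 5 (λ t n l l₁ l₂ → t :- n :- n :* (l :- l₁) :+ n :* (l₂ :- l₁) := n :* l₂ :- n :- (n :* l :- t))
        refl t (fromℕ n) (log t) (log (fromℕ n)) (log (fromℕ (suc n)))))
    (log!-≥ n)

  0≤⇒≡0⊎0< : ∀ {x} → 0# ≤ x → x ≡ 0# ⊎ 0# < x
  0≤⇒≡0⊎0< {x} 0≤x with ≤-<-connex x 0#
  ... | inj₁ x≤0 = inj₁ (≤-antisym x≤0 0≤x)
  ... | inj₂ 0<x = inj₂ 0<x

  -- Together with `xlogx≥` this exchanges `log a` for `log (1 + a)` at a cost of at most 1, which
  -- hides the junk value of `log 0#` from the later estimates.
  xlogx≤ : ∀ {a} → 0# ≤ a → xlogx a ≤ a * log (1# + a)
  xlogx≤ {a} 0≤a with 0≤⇒≡0⊎0< 0≤a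
  ... | inj₁ refl = ≤-reflexive (trans (zeroˡ _) (sym (zeroˡ _)))
  ... | inj₂ 0<a  = *-monoˡ-≤ 0≤a (log-mono-≤ 0<a (≤-by 0≤1 (solve 1 (λ a → :1 := :1 :+ a :- a) refl a)))

  xlogx≥ : ∀ {a} → 0# ≤ a → a * log (1# + a) - 1# ≤ xlogx a
  xlogx≥ {a} 0≤a with 0≤⇒≡0⊎0< 0≤a
  ... | inj₁ refl = ≤-by 0≤1 (solve 2 (λ l l′ → :1 := :0 :* l′ :- (:0 :* l :- :1)) refl (log (1# + 0#)) (log 0#))
  ... | inj₂ 0<a  = ≤-by (Δ≥0 (log-tangent 0<a (0<1 <⊹ 0≤a)))
    (solve 3 (λ a l l′ → :1 :+ a :- a :- a :* (l :- l′) := a :* l′ :- (a :* l :- :1)) refl a (log (1# + a)) (log a))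

  -- One unit of the constant 2 comes from `xlogx≥`, the other from replacing `- n` by `1 - a`.
  log!-upper : ∀ {a n} → fromℕ n ≤ a → a < fromℕ (suc n) → log! n ≤ xlogx a - a + log (1# + a) + (1# + 1#)
  log!-upper {a} {n} n≤a a<n+1 = ≤-trans (log!-≤ n) (≤-by
    (Δ≥0 (*-mono-≤ (≤-trans (0≤fromℕ (suc n)) n+1≤a+1) (0≤log (1≤fromℕ {suc n} (ℕ.s≤s ℕ.z≤n))) n+1≤a+1 (log-mono-≤ (0<fromℕ-suc n) n+1≤a+1))
      ⊹ Δ≥0 (xlogx≥ (≤-trans (0≤fromℕ n) n≤a)) ⊹ Δ≥0 (<⇒≤ a<n+1))
    (solve 5 (λ a n l l′ x → (:1 :+ a) :* l :- (:1 :+ n) :* l′ :+ (x :- (a :* l :- :1)) :+ (:1 :+ n :- a)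
        := x :- a :+ l :+ (:1 :+ :1) :- ((:1 :+ n) :* l′ :- n))
      refl a (fromℕ n) (log (1# + a)) (log (fromℕ (suc n))) (xlogx a)))
    where
    n+1≤a+1 : fromℕ (suc n) ≤ 1# + a
    n+1≤a+1 = +-monoʳ-≤ 1# n≤a

  -- Apply `n*log[t]-t≤log!` with `t = 1 + a`. The parameter `m` is the rounding loss; each unit of
  -- it costs `log (1 + a)`.
  log!-lower : ∀ {a m n} → 0# ≤ a → a - m ≤ fromℕ n → xlogx a - a - m * log (1# + a) - 1# ≤ log! n
  log!-lower {a} {m} {n} 0≤a a-m≤n = ≤-trans (≤-by
    (Δ≥0 (xlogx≤ 0≤a) ⊹ 0≤log (≤-by 0≤a (solve 1 (λ a → a := :1 :+ a :- :1) refl a)) ⊠ Δ≥0 a-m≤n)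
    (solve 5 (λ a m n l x → a :* l :- x :+ l :* (n :- (a :- m)) := n :* l :- (:1 :+ a) :- (x :- a :- m :* l :- :1))
      refl a m (fromℕ n) (log (1# + a)) (xlogx a)))
    (n*log[t]-t≤log! n (0<1 <⊹ 0≤a))

  -- The first summand is linear in `x`, so it cancels between `xlogx` of a sum and the sum of the
  -- `xlogx`; the entropy therefore scales by exactly `s`.
  xlogx-* : ∀ {s x} → 0# < s → 0# ≤ x → xlogx (s * x) ≡ s * log s * x + s * xlogx x
  xlogx-* {s} {x} 0<s 0≤x with 0≤⇒≡0⊎0< 0≤x
  ... | inj₁ refl = solve 4 (λ s l l₁ l₂ → s :* :0 :* l := s :* l₁ :* :0 :+ s :* (:0 :* l₂)) refl s (log (s * 0#)) (log s) (log 0#)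
  ... | inj₂ 0<x  = trans (cong (_*_ (s * x)) (log-* 0<s 0<x))
    (solve 4 (λ s x l₁ l₂ → s :* x :* (l₁ :+ l₂) := s :* l₁ :* x :+ s :* (x :* l₂)) refl s x (log s) (log x))

  log-below-linear : ∀ {β S g} C → 0# ≤ β → 0# ≤ S → 0# < g →
                     ∃ λ M → ∀ s → M ℕ.≤ s → β * log (1# + fromℕ s * S) + C < g * fromℕ s
  log-below-linear {β} {S} {g} C 0≤β 0≤S 0<g = M , λ s M≤s → *-cancelˡ-< 0<K (begin-strict
      K * (β * log (1# + fromℕ s * S) + C)
        ≤⟨ ≤-by (0≤β ⊠ Δ≥0 (log-tangent 0<K (0<1 <⊹ 0≤fromℕ s ⊠ 0≤S)) ⊹ 0≤β ⊠ <⇒≤ 0<K)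
             (solve 7 (λ K β l C s S k → β :* (:1 :+ s :* S :- K :- K :* (l :- k)) :+ β :* K
               := β :* S :* s :+ (β :* (:1 :+ K :* k) :+ K :* C) :- K :* (β :* l :+ C))
               refl K β (log (1# + fromℕ s * S)) C (fromℕ s) S (log K)) ⟩
      β * S * fromℕ s + C′
        <⟨ <-by (Δ>0 (<-≤-trans C′<gM (*-monoˡ-≤ (<⇒≤ 0<g) (fromℕ-mono-≤ M≤s))) <⊹ (0≤β ⊠ 0≤S ⊠ 0≤fromℕ s))
             (solve 4 (λ b g s C → g :* s :- C :+ b :* s := (b :+ b :+ g) :* s :- (b :* s :+ C))
               refl (β * S) g (fromℕ s) C′) ⟩
      (β * S + β * S + g) * fromℕ s
        ≡⟨ cong (λ z → z * fromℕ s) gK ⟨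
      g * K * fromℕ s
        ≡⟨ solve 3 (λ g K s → g :* K :* s := K :* (g :* s)) refl g K (fromℕ s) ⟩
      K * (g * fromℕ s) ∎)
    where
    open ≤-Reasoning
    -- The tangent to `log` at `K` bounds `K β log (1 + s S) + K C` by `β S s + C′`. With this `K`,
    -- the target `g K s` exceeds `β S s` by at least `g s`, which absorbs `C′` once `s ≥ M`.
    K = (β * S + β * S) / g + 1#
    0<K : 0# < K
    0<K = (0≤β ⊠ 0≤S ⊹ 0≤β ⊠ 0≤S) ⊠ <⇒≤ (0<x⁻¹ 0<g) ⊹< 0<1
    gK : g * K ≡ β * S + β * S + g
    gK = trans (solve 2 (λ g y → g :* (y :+ :1) := g :* y :+ g) refl g _) (cong (λ z → z + g) (x*[y/x]≡y _ 0<g))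
    C′ = β * (1# + K * log K) + K * C
    M = proj₁ (archimedean (C′ / g))
    C′<gM : C′ < g * fromℕ M
    C′<gM = subst (_< g * fromℕ M) (x*[y/x]≡y C′ 0<g) (*-monoˡ-< 0<g (proj₂ (archimedean (C′ / g))))

open MonoidSum ℕ.+-0-commutativeMonoid using () renaming (sum to ∑; sum-cong-≗ to ∑-cong; sum-replicate-zero to ∑-zero)
open MonoidSum ℕ.*-1-commutativeMonoid using () renaming (sum to ∏; sum-cong-≗ to ∏-cong)
open SemiringSum ℕ.+-*-semiring using (*-distribʳ-sum)

if-2≤ : ∀ {A : Set} (P : A → Set) {x y} d → (2 ℕ.≤ d → P x) → (¬ 2 ℕ.≤ d → P y) → P (if does (2 ℕ.≤? d) then x else y)
if-2≤ P 0 yes-case no-case = no-case λ ()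
if-2≤ P 1 yes-case no-case = no-case λ { (ℕ.s≤s ()) }
if-2≤ P (suc (suc d)) yes-case no-case = yes-case (ℕ.s≤s (ℕ.s≤s ℕ.z≤n))

-- Prime valuations and divisibility

module Valuations where
  open import Data.Nat.Base
  open ≡-Reasoning

  -- An upper bound for the valuation, phrased through divisibility so that it adds up along
  -- products without evaluating `ν` on them.
  ValuationAtMost : ℕ → ℕ → ℕ → Set
  ValuationAtMost p m v = ∀ k → p ^ k ∣ m → k ≤ v

  -- Euclid's lemma assigns one factor `p` to `m` or to `n`; cancel it and recurse.
  ∣*⇒split : ∀ {p} → Prime p → ∀ k m n → p ^ k ∣ m * n → ∃₂ λ i j → i + j ≡ k × p ^ i ∣ m × p ^ j ∣ n
  ∣*⇒split pr zero m n _ = 0 , 0 , refl , 1∣ m , 1∣ n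
  ∣*⇒split {p} pr (suc k) m n p^k+1∣mn with euclidsLemma m n pr (∣-trans (m∣m*n (p ^ k)) p^k+1∣mn)
  ... | inj₁ (divides q refl)
    with i , j , refl , p^i∣q , p^j∣n ← ∣*⇒split pr k q n (*-cancelˡ-∣ p {{prime⇒nonZero pr}} (subst (p ^ suc k ∣_) (begin
           q * p * n    ≡⟨ cong (_* n) (ℕ.*-comm q p) ⟩
           p * q * n    ≡⟨ ℕ.*-assoc p q n ⟩
           p * (q * n)  ∎) p^k+1∣mn))
    = suc i , j , refl , subst (p ^ suc i ∣_) (ℕ.*-comm p q) (*-monoʳ-∣ p p^i∣q) , p^j∣n
  ... | inj₂ (divides q refl)
    with i , j , refl , p^i∣m , p^j∣q ← ∣*⇒split pr k m q (*-cancelˡ-∣ p {{prime⇒nonZero pr}} (subst (p ^ suc k ∣_) (begin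
           m * (q * p)  ≡⟨ ℕ.*-assoc m q p ⟨
           m * q * p    ≡⟨ ℕ.*-comm (m * q) p ⟩
           p * (m * q)  ∎) p^k+1∣mn))
    = i , suc j , ℕ.+-suc i j , p^i∣m , subst (p ^ suc j ∣_) (ℕ.*-comm p q) (*-monoʳ-∣ p p^j∣q)

  valuation-1 : ∀ {p} → Prime p → ValuationAtMost p 1 0
  valuation-1 pr zero    _       = z≤n
  valuation-1 pr (suc k) p^k+1∣1 = contradiction (ℕ.≤-trans (ℕ.m≤m*n _ _ {{ℕ.m^n≢0 _ k {{prime⇒nonZero pr}}}}) (∣⇒≤ p^k+1∣1))
                                                  (ℕ.<⇒≱ (nonTrivial⇒n>1 _ {{prime⇒nonTrivial pr}}))

  valuation-∤ : ∀ {p m} → p ∤ m → ValuationAtMost p m 0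
  valuation-∤ p∤m zero    _       = z≤n
  valuation-∤ p∤m (suc k) p^k+1∣m = contradiction (∣-trans (m∣m*n _) p^k+1∣m) p∤m

  valuation-* : ∀ {p m n v w} → Prime p →
                ValuationAtMost p m v → ValuationAtMost p n w → ValuationAtMost p (m * n) (v + w)
  valuation-* {m = m} {n} pr ≤v ≤w k p^k∣mn with i , j , refl , p^i∣m , p^j∣n ← ∣*⇒split pr k m n p^k∣mn =
    ℕ.+-mono-≤ (≤v i p^i∣m) (≤w j p^j∣n)

  valuation-^ : ∀ {p m v} → Prime p → ∀ n → ValuationAtMost p m v → ValuationAtMost p (m ^ n) (n * v)
  valuation-^ pr zero    ≤v = valuation-1 pr
  valuation-^ pr (suc n) ≤v = valuation-* pr ≤v (valuation-^ pr n ≤v)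

  valuation-∏ : ∀ {p b} {f v : Fin b → ℕ} → Prime p →
                (∀ d → ValuationAtMost p (f d) (v d)) → ValuationAtMost p (∏ f) (∑ v)
  valuation-∏ {b = zero}  pr ≤v = valuation-1 pr
  valuation-∏ {b = suc b} pr ≤v = valuation-* pr (≤v zero) (valuation-∏ pr (≤v ∘ suc))

  greatestExponent-maximal : ∀ K {p n k} → k ≤ K → p ^ k ∣ n → k ≤ greatestExponent≤ K p n
  greatestExponent-maximal zero    k≤0 _ = k≤0
  greatestExponent-maximal (suc K) {p} {n} {k} k≤K+1 p^k∣n with p ^ suc K ∣? n
  ... | yes _ = k≤K+1
  ... | no  p^K+1∤n with ℕ.m≤n⇒m<n∨m≡n k≤K+1
  ...   | inj₁ k<K+1 = greatestExponent-maximal K (s≤s⁻¹ k<K+1) p^k∣n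
  ...   | inj₂ refl  = contradiction p^k∣n p^K+1∤n

  n<p^n : ∀ {p} → 1 < p → ∀ n → n < p ^ n
  n<p^n 1<p zero = ℕ.≤-refl
  n<p^n {p} 1<p (suc n) = ℕ.≤-trans (s≤s (n<p^n 1<p n)) (ℕ.≤-trans
    (ℕ.+-mono-≤ (ℕ.m^n>0 p {{>-nonZero (ℕ.<-trans z<s 1<p)}} n) (ℕ.≤-reflexive (sym (ℕ.+-identityʳ (p ^ n)))))
    (ℕ.*-monoˡ-≤ (p ^ n) 1<p))

  valuation-ν : ∀ {p n} → Prime p → 1 ≤ n → ValuationAtMost p n (ν p n)
  valuation-ν {p} {n} pr 1≤n k p^k∣n = greatestExponent-maximal n
    (ℕ.<⇒≤ (ℕ.<-≤-trans (n<p^n (nonTrivial⇒n>1 p {{prime⇒nonTrivial pr}}) k) (∣⇒≤ {{>-nonZero 1≤n}} p^k∣n))) p^k∣n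

  -- Strip the prime factors `p` of `m` one at a time, dividing `n` by `p` as well. The local
  -- hypothesis survives: for `q = p` one power cancels on both sides, and for `q ≠ p` no positive
  -- power of `q` divides `p`, so the whole power divides the cofactor.
  primePowers⇒∣ : ∀ m n .{{_ : NonZero m}} → (∀ p → Prime p → ∀ k → p ^ k ∣ m → p ^ k ∣ n) → m ∣ n
  primePowers⇒∣ m n local = subst (_∣ n) (sym (PrimeFactorisation.isFactorisation f))
    (go (PrimeFactorisation.factors f) (PrimeFactorisation.factorsPrime f) n
      (subst (λ m → ∀ p → Prime p → ∀ k → p ^ k ∣ m → p ^ k ∣ n) (PrimeFactorisation.isFactorisation f) local))
    where
    f = factorise m
    go : ∀ ps → All Prime ps → ∀ n → (∀ p → Prime p → ∀ k → p ^ k ∣ product ps → p ^ k ∣ n) → product ps ∣ n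
    go [] [] n local = 1∣ n
    go (p ∷ ps) (pr ∷ prs) n local
      with subst (_∣ n) (ℕ.*-identityʳ p) (local p pr 1 (subst (_∣ p * product ps) (sym (ℕ.*-identityʳ p)) (m∣m*n (product ps))))
    ... | divides n′ refl = subst (p * product ps ∣_) (ℕ.*-comm p n′) (*-monoʳ-∣ p (go ps prs n′ local′))
      where
      local′ : ∀ q → Prime q → ∀ k → q ^ k ∣ product ps → q ^ k ∣ n′
      local′ q qr k q^k∣ps with q ℕ.≟ p
      ... | yes refl = *-cancelˡ-∣ p {{prime⇒nonZero pr}} (subst (p ^ suc k ∣_) (ℕ.*-comm n′ p) (local p pr (suc k) (*-monoʳ-∣ p q^k∣ps)))
      ... | no  q≢p  with ∣*⇒split qr k p n′ (subst (q ^ k ∣_) (ℕ.*-comm n′ p) (local q qr k (∣n⇒∣m*n p q^k∣ps)))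
      ...   | zero  , j , refl , _ , q^j∣n = q^j∣n
      ...   | suc i , j , refl , q^i+1∣p , _ with prime⇒irreducible pr {q} (∣-trans (m∣m*n (q ^ i)) q^i+1∣p)
      ...     | inj₁ refl = contradiction refl (ℕ.<⇒≢ (nonTrivial⇒n>1 1 {{prime⇒nonTrivial qr}}))
      ...     | inj₂ q≡p  = contradiction q≡p q≢p

  p^k∣n^k : ∀ {p n} k → p ∣ n → p ^ k ∣ n ^ k
  p^k∣n^k zero    _   = ∣-refl
  p^k∣n^k (suc k) p∣n = *-pres-∣ p∣n (p^k∣n^k k p∣n)

module _ (M : CommutativeMonoid 0ℓ 0ℓ) where
  open CommutativeMonoid M using (Carrier; _∙_; _≈_; ∙-cong; commutativeSemigroup)
  open CommutativeSemigroupProperties commutativeSemigroup using (x∙yz≈y∙xz)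
  open CommutativeMonoid M using (assoc) renaming (trans to ≈-trans; sym to ≈-sym)
  open MonoidSum M using (sum; sum-cong-≋)

  -- Stated for any commutative monoid so that it serves both the sum of the counts and products
  -- over them when one letter is removed.
  sum-split : ∀ {n} {f h : Fin n → Carrier} {a} d →
              f d ≈ a ∙ h d → (∀ i → i ≢ d → f i ≈ h i) → sum f ≈ a ∙ sum h
  sum-split zero fd≈ahd f≈h =
    ≈-trans (∙-cong fd≈ahd (sum-cong-≋ λ i → f≈h (suc i) λ ())) (assoc _ _ _)
  sum-split (suc d) fd≈ahd f≈h = ≈-trans
    (∙-cong (f≈h zero λ ()) (sum-split d fd≈ahd λ i i≢d → f≈h (suc i) (i≢d ∘ Fin.suc-injective)))
    (x∙yz≈y∙xz _ _ _)

∑-mono-≤ : ∀ {m} {f h : Fin m → ℕ} → (∀ i → f i ℕ.≤ h i) → ∑ f ℕ.≤ ∑ h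
∑-mono-≤ {zero}  f≤h = ℕ.z≤n
∑-mono-≤ {suc m} f≤h = ℕ.+-mono-≤ (f≤h zero) (∑-mono-≤ (f≤h ∘ suc))

1≤∏ : ∀ {m} {f : Fin m → ℕ} → (∀ i → 1 ℕ.≤ f i) → 1 ℕ.≤ ∏ f
1≤∏ {zero}  1≤f = ℕ.≤-refl
1≤∏ {suc m} 1≤f = ℕ.*-mono-≤ (1≤f zero) (1≤∏ (1≤f ∘ suc))

-- Words with prescribed letter counts

module Words {b : ℕ} where
  open import Data.Nat.Base

  infixl 6 _∖_
  -- Since `pred 0` is 0, this removes a letter only if one is left; `wordsFrom` tests for that.
  _∖_ : (Fin b → ℕ) → Fin b → Fin b → ℕ
  c ∖ d = updateAt c d pred

  ∏-∖ : ∀ (f : Fin b → ℕ → ℕ) a c d → f d (c d) ≡ a * f d (pred (c d)) →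
        ∏ (λ i → f i (c i)) ≡ a * ∏ (λ i → f i ((c ∖ d) i))
  ∏-∖ f a c d eq = sum-split ℕ.*-1-commutativeMonoid {f = λ i → f i (c i)} {h = λ i → f i ((c ∖ d) i)} {a = a} d
    (trans eq (cong (λ k → a * f d k) (sym (Vector.updateAt-updates d c))))
    (λ i i≢d → cong (f i) (sym (Vector.updateAt-minimal i d c i≢d)))

  ∑-∖ : ∀ c d {k} → c d ≡ suc k → ∑ c ≡ suc (∑ (c ∖ d))
  ∑-∖ c d {k} cd≡k+1 = sum-split ℕ.+-0-commutativeMonoid {f = c} {h = c ∖ d} {a = 1} d
    (trans cd≡k+1 (cong suc (sym (trans (Vector.updateAt-updates d c) (cong pred cd≡k+1)))))
    (λ i i≢d → sym (Vector.updateAt-minimal i d c i≢d))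

  -- Words of length `n` in which each `d` occurs at most `c d` times. For `n = ∑ c` this forces
  -- exactly `c d` occurrences.
  words     : ℕ → (Fin b → ℕ) → List (List (Fin b))
  wordsFrom : ℕ → (Fin b → ℕ) → Fin b → List (List (Fin b))
  words zero    c = [] ∷ []
  words (suc n) c = concat (tabulate (wordsFrom n c))
  wordsFrom n c d = if c d ≡ᵇ 0 then [] else map (d ∷_) (words n (c ∖ d))

  ∈-wordsFrom⁻ : ∀ {n c d w} → w ∈ wordsFrom n c d →
                 ∃₂ λ k v → c d ≡ suc k × w ≡ d ∷ v × v ∈ words n (c ∖ d)
  ∈-wordsFrom⁻ {n} {c} {d} {w} w∈ with c d in eq
  ... | zero  = contradiction w∈ λ ()
  ... | suc k with v , v∈ , refl ← ∈.∈-map⁻ (d ∷_) w∈ = k , v , refl , refl , v∈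

  ∈-words⁻ : ∀ {n c w} → w ∈ words (suc n) c →
             ∃ λ d → ∃₂ λ k v → c d ≡ suc k × w ≡ d ∷ v × v ∈ words n (c ∖ d)
  ∈-words⁻ {n} {c} w∈ with ∈.∈-concat⁻′ (tabulate (wordsFrom n c)) w∈
  ... | _ , w∈ws , ws∈ with d , refl ← ∈.∈-tabulate⁻ ws∈ = d , ∈-wordsFrom⁻ {n} w∈ws

  words-length : ∀ n c {w} → w ∈ words n c → length w ≡ n
  words-length zero    c (here refl) = refl
  words-length (suc n) c w∈ with d , _ , v , _ , refl , v∈ ← ∈-words⁻ {n} w∈ = cong suc (words-length n (c ∖ d) v∈)

  words-product : ∀ (g : Fin b → ℕ) n c {w} → w ∈ words n c → product (map g w) ∣ ∏ (λ d → g d ^ c d)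
  words-product g zero    c (here refl) = 1∣ _
  words-product g (suc n) c w∈ with d , k , v , cd≡k+1 , refl , v∈ ← ∈-words⁻ {n} w∈ =
    subst (product (map g (d ∷ v)) ∣_) (sym (∏-∖ (λ i k → g i ^ k) (g d) c d
      (trans (cong (g d ^_) cd≡k+1) (cong (λ k → g d * g d ^ pred k) (sym cd≡k+1)))))
      (*-monoʳ-∣ (g d) (words-product g n (c ∖ d) v∈))

  words-unique : ∀ n c → Unique (words n c)
  words-unique zero    c = [] ∷ []
  words-unique (suc n) c = Unique.concat⁺ (All.tabulate⁺ unique) (AllPairs.tabulate⁺ disjoint)
    where
    unique : ∀ d → Unique (wordsFrom n c d)
    unique d with c d
    ... | zero  = []
    ... | suc _ = Unique.map⁺ List.∷-injectiveʳ (words-unique n (c ∖ d))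
    disjoint : ∀ {i j} → i ≢ j → Disjoint (wordsFrom n c i) (wordsFrom n c j)
    disjoint i≢j (w∈i , w∈j)
      with _ , _ , _ , refl , _ ← ∈-wordsFrom⁻ {n} w∈i
      with _ , _ , _ , refl , _ ← ∈-wordsFrom⁻ {n} w∈j = i≢j refl

  length-concat-tabulate : ∀ {A : Set} {m} (f : Fin m → List A) → length (concat (tabulate f)) ≡ ∑ (length ∘ f)
  length-concat-tabulate {m = zero}  f = refl
  length-concat-tabulate {m = suc m} f =
    trans (List.length-++ (f zero)) (cong (length (f zero) +_) (length-concat-tabulate (f ∘ suc)))

  -- The multinomial bound with its denominator cleared. Write `(n + 1) n!` as the sum of
  -- `c d * n!`. The words starting with `d` account for one summand, since `c d` times the product
  -- of factorials after removing `d` is the original product.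
  n!≤words*∏! : ∀ n c → ∑ c ≡ n → n ! ≤ length (words n c) * ∏ (λ d → c d !)
  n!≤words*∏! zero    c _ = ℕ.≤-trans (1≤∏ (ℕ.1≤n! ∘ c)) (ℕ.≤-reflexive (sym (ℕ.*-identityˡ _)))
  n!≤words*∏! (suc n) c ∑c≡n+1 = begin
    suc n * n !                                    ≡⟨ cong (_* n !) ∑c≡n+1 ⟨
    ∑ c * n !                                      ≡⟨ *-distribʳ-sum (n !) c ⟩
    ∑ (λ d → c d * n !)                            ≤⟨ ∑-mono-≤ step ⟩
    ∑ (λ d → length (wordsFrom n c d) * P)         ≡⟨ *-distribʳ-sum P (length ∘ wordsFrom n c) ⟨
    ∑ (length ∘ wordsFrom n c) * P                 ≡⟨ cong (_* P) (length-concat-tabulate (wordsFrom n c)) ⟨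
    length (words (suc n) c) * P                   ∎
    where
    open ℕ.≤-Reasoning
    P = ∏ (λ d → c d !)
    step : ∀ d → c d * n ! ≤ length (wordsFrom n c d) * P
    step d with c d in eq
    ... | zero  = z≤n
    ... | suc k = begin
      suc k * n !                                              ≤⟨ ℕ.*-monoʳ-≤ (suc k)
        (n!≤words*∏! n (c ∖ d) (ℕ.suc-injective (trans (sym (∑-∖ c d eq)) ∑c≡n+1))) ⟩
      suc k * (length (words n (c ∖ d)) * P′)                  ≡⟨ cong (λ y → suc k * (y * P′)) (List.length-map (d ∷_) (words n (c ∖ d))) ⟨
      suc k * (length (map (d ∷_) (words n (c ∖ d))) * P′)     ≡⟨ x∙yz≈y∙xz (suc k) (length (map (d ∷_) (words n (c ∖ d)))) P′ ⟩
      length (map (d ∷_) (words n (c ∖ d))) * (suc k * P′)     ≡⟨ cong (length (map (d ∷_) (words n (c ∖ d))) *_)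
        (∏-∖ (λ _ → _!) (suc k) c d (trans (cong _! eq) (cong (λ j → suc k * pred j !) (sym eq)))) ⟨
      length (map (d ∷_) (words n (c ∖ d))) * P                ∎
      where
      open CommutativeSemigroupProperties (CommutativeMonoid.commutativeSemigroup ℕ.*-1-commutativeMonoid) using (x∙yz≈y∙xz)
      P′ = ∏ (λ i → (c ∖ d) i !)

-- Base b expansions and the constructed numbers

module Digits (b₋₂ : ℕ) where
  open import Data.Nat.Base
  open Words

  b : ℕ
  b = 2+ b₋₂

  -- Counting the digit 0 as a factor 1 turns the filtered product into a product over all digits.
  digitFactor : ℕ → ℕ
  digitFactor zero    = 1
  digitFactor (suc d) = suc d

  nonzeroProduct : Expansion b → ℕ
  nonzeroProduct ds = product (filter (λ d → ¬? (d ℕ.≟ 0)) (map toℕ ds))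

  nonzeroProduct≡ : ∀ ds → nonzeroProduct ds ≡ product (map (digitFactor ∘ toℕ) ds)
  nonzeroProduct≡ [] = refl
  nonzeroProduct≡ (d ∷ ds) with toℕ d
  ... | zero  = trans (nonzeroProduct≡ ds) (sym (ℕ.*-identityˡ _))
  ... | suc k = cong (suc k *_) (nonzeroProduct≡ ds)

  digitProduct : Expansion b → ℕ
  digitProduct ds = product (map (digitFactor ∘ toℕ) ds)

  digit-injective : ∀ (d e : Fin b) m n → toℕ d + m * b ≡ toℕ e + n * b → d ≡ e × m ≡ n
  digit-injective d e m n eq = Fin.toℕ-injective d≡e ,
    ℕ.*-cancelʳ-≡ m n b (ℕ.+-cancelˡ-≡ (toℕ d) _ _ (trans eq (cong (_+ n * b) (sym d≡e))))
    where
    d≡e : toℕ d ≡ toℕ e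
    d≡e = begin
      toℕ d                ≡⟨ m<n⇒m%n≡m (Fin.toℕ<n d) ⟨
      toℕ d % b            ≡⟨ [m+kn]%n≡m%n (toℕ d) m b ⟨
      (toℕ d + m * b) % b  ≡⟨ cong (_% b) eq ⟩
      (toℕ e + n * b) % b  ≡⟨ [m+kn]%n≡m%n (toℕ e) n b ⟩
      toℕ e % b            ≡⟨ m<n⇒m%n≡m (Fin.toℕ<n e) ⟩
      toℕ e                ∎
      where open ≡-Reasoning

  digitProduct-0 : ∀ ds → fromDigits ds ≡ 0 → digitProduct ds ≡ 1
  digitProduct-0 []       _  = refl
  digitProduct-0 (d ∷ ds) eq with digit-injective d zero (fromDigits ds) 0 eq
  ... | refl , ds≡0 = trans (ℕ.*-identityˡ _) (digitProduct-0 ds ds≡0)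

  -- Two expansions of one number differ only in leading zeros, whose factor is 1. Hence the digits
  -- chosen by `toDigits` may be replaced by those of the construction.
  digitProduct-unique : ∀ ds es → fromDigits ds ≡ fromDigits es → digitProduct ds ≡ digitProduct es
  digitProduct-unique []       es       eq = sym (digitProduct-0 es (sym eq))
  digitProduct-unique (d ∷ ds) []       eq = digitProduct-0 (d ∷ ds) eq
  digitProduct-unique (d ∷ ds) (e ∷ es) eq with digit-injective d e (fromDigits ds) (fromDigits es) eq
  ... | refl , ds≡es = cong (digitFactor (toℕ d) *_) (digitProduct-unique ds es ds≡es)

  nonzeroDigitProduct-fromDigits : ∀ 2≤b ds → nonzeroDigitProduct b 2≤b (fromDigits ds) ≡ digitProduct ds
  nonzeroDigitProduct-fromDigits 2≤b ds = let es , eq = toDigits b (fromDigits ds) in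
    trans (nonzeroProduct≡ es) (digitProduct-unique es ds eq)

  fromDigits-injective : ∀ (ds es : Expansion b) → length ds ≡ length es → fromDigits ds ≡ fromDigits es → ds ≡ es
  fromDigits-injective []       []       _ _ = refl
  fromDigits-injective (d ∷ ds) (e ∷ es) ∣ds∣≡∣es∣ eq with digit-injective d e (fromDigits ds) (fromDigits es) eq
  ... | refl , ds≡es = cong (d ∷_) (fromDigits-injective ds es (ℕ.suc-injective ∣ds∣≡∣es∣) ds≡es)

  fromDigits<b^length : ∀ (ds : Expansion b) → fromDigits ds < b ^ length ds
  fromDigits<b^length []       = ℕ.≤-refl
  fromDigits<b^length (d ∷ ds) = begin-strict
    toℕ d + fromDigits ds * b  <⟨ ℕ.+-monoˡ-< (fromDigits ds * b) (Fin.toℕ<n d) ⟩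
    suc (fromDigits ds) * b    ≤⟨ ℕ.*-monoˡ-≤ b (fromDigits<b^length ds) ⟩
    b ^ length ds * b          ≡⟨ ℕ.*-comm (b ^ length ds) b ⟩
    b * b ^ length ds          ∎
    where open ℕ.≤-Reasoning

  -- The expansion 1 w 0 ⋯ 0 with s trailing zeros, least significant digit first.

  padded : ℕ → Expansion b → Expansion b
  padded zero    w = w ++ suc zero ∷ []
  padded (suc s) w = zero ∷ padded s w

  b^s∣padded : ∀ s w → b ^ s ∣ fromDigits (padded s w)
  b^s∣padded zero    w = 1∣ _
  b^s∣padded (suc s) w = subst (b ^ suc s ∣_) (ℕ.*-comm b (fromDigits (padded s w))) (*-monoʳ-∣ b (b^s∣padded s w))

  length-padded : ∀ s w → length (padded s w) ≡ s + suc (length w)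
  length-padded zero    w = trans (List.length-++ w) (ℕ.+-comm (length w) 1)
  length-padded (suc s) w = cong suc (length-padded s w)

  1≤padded : ∀ s w → 1 ≤ fromDigits (padded s w)
  1≤padded zero    []      = ℕ.≤-refl
  1≤padded zero    (d ∷ w) = ℕ.≤-trans (ℕ.*-mono-≤ (1≤padded zero w) (s≤s {n = suc b₋₂} z≤n)) (ℕ.m≤n+m _ (toℕ d))
  1≤padded (suc s) w       = ℕ.*-mono-≤ (1≤padded s w) (s≤s {n = suc b₋₂} z≤n)

  padded-injective : ∀ s {v w} → padded s v ≡ padded s w → v ≡ w
  padded-injective zero    {v} {w} eq = List.++-cancelʳ (suc zero ∷ []) v w eq
  padded-injective (suc s) eq = padded-injective s (List.∷-injectiveʳ eq)

  digitProduct-padded : ∀ s w → digitProduct (padded s w) ≡ digitProduct w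
  digitProduct-padded zero    []      = refl
  digitProduct-padded zero    (d ∷ w) = cong (digitFactor (toℕ d) *_) (digitProduct-padded zero w)
  digitProduct-padded (suc s) w       = trans (ℕ.*-identityˡ _) (digitProduct-padded s w)

  open Valuations

  -- The left side of the valuation condition for integer counts, with the same conditional as in
  -- `Admissible` so that the two can be compared term by term.
  restrictedSum : (Fin b → ℕ) → ℕ → ℕ
  restrictedSum c p = ∑ λ d → if does (2 ℕ.≤? toℕ d) then c d * ν p (toℕ d) else 0

  ∏digitFactor∣b^s : ∀ c s →
    (∀ d → 2 ≤ toℕ d → c d ≢ 0 → ∀ p → Prime p → p ∣ toℕ d → p ∣ b) →
    (∀ p → Prime p → p ∣ b → restrictedSum c p ≤ s) →
    ∏ (λ d → digitFactor (toℕ d) ^ c d) ∣ b ^ s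
  ∏digitFactor∣b^s c s support valuation = primePowers⇒∣ _ (b ^ s) {{>-nonZero (1≤∏ {f = λ d → digitFactor (toℕ d) ^ c d} 1≤factor)}} local
    where
    1≤digitFactor : ∀ d → 1 ≤ digitFactor d
    1≤digitFactor zero    = ℕ.≤-refl
    1≤digitFactor (suc d) = s≤s z≤n

    1≤factor : ∀ d → 1 ≤ digitFactor (toℕ d) ^ c d
    1≤factor d = ℕ.m^n>0 _ {{>-nonZero (1≤digitFactor (toℕ d))}} (c d)

    small : ∀ {p} → Prime p → ∀ d n → ¬ 2 ≤ d → ValuationAtMost p (digitFactor d ^ n) 0
    small {p} pr d n d<2 = subst₂ (ValuationAtMost p) (trans (sym (ℕ.^-zeroˡ n)) (cong (_^ n) (sym (factor≡1 d d<2)))) (refl {x = 0}) (valuation-1 pr)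
      where
      factor≡1 : ∀ d → ¬ 2 ≤ d → digitFactor d ≡ 1
      factor≡1 0      _   = refl
      factor≡1 1      _   = refl
      factor≡1 (2+ d) d<2 = contradiction (s≤s (s≤s z≤n)) d<2

    large : ∀ d n {P : ℕ → Set} → 2 ≤ d → P (d ^ n) → P (digitFactor d ^ n)
    large (suc _) n _ p = p

    local : ∀ p → Prime p → ∀ k → p ^ k ∣ ∏ (λ d → digitFactor (toℕ d) ^ c d) → p ^ k ∣ b ^ s
    local p pr k p^k∣∏ with p ∣? b
    -- The exponent `k` is at most `s`, and `p^k` divides `b^k`, which divides `b^s`.
    ... | yes p∣b = ∣-trans (p^k∣n^k k p∣b) (m≤n⇒b^m∣b^n (ℕ.≤-trans (valuation-∏ pr factor≤ k p^k∣∏) (valuation p pr p∣b)))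
      where
      m≤n⇒b^m∣b^n : ∀ {m n} → m ≤ n → b ^ m ∣ b ^ n
      m≤n⇒b^m∣b^n {m} {n} m≤n = divides (b ^ (n ∸ m)) (trans (cong (b ^_) (sym (ℕ.m∸n+n≡m m≤n))) (ℕ.^-distribˡ-+-* b (n ∸ m) m))
      factor≤ : ∀ d → ValuationAtMost p (digitFactor (toℕ d) ^ c d) (if does (2 ℕ.≤? toℕ d) then c d * ν p (toℕ d) else 0)
      factor≤ d = if-2≤ (ValuationAtMost p (digitFactor (toℕ d) ^ c d)) (toℕ d)
        (λ 2≤d → large (toℕ d) (c d) {λ m → ValuationAtMost p m (c d * ν p (toℕ d))} 2≤d
                   (valuation-^ pr (c d) (valuation-ν pr (ℕ.<⇒≤ 2≤d))))
        (small pr (toℕ d) (c d))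
    -- No digit `d ≥ 2` with `c d > 0` is divisible by `p`, so every factor has valuation 0 and `k`
    -- vanishes.
    ... | no p∤b = subst (λ k → p ^ k ∣ b ^ s) (sym (ℕ.n≤0⇒n≡0 (subst (k ≤_) (∑-zero b) (valuation-∏ pr factor≤ k p^k∣∏)))) (1∣ _)
      where
      factor≤ : ∀ d → ValuationAtMost p (digitFactor (toℕ d) ^ c d) 0
      factor≤ d with 2 ℕ.≤? toℕ d | c d ℕ.≟ 0
      ... | no  d<2 | _      = small pr (toℕ d) (c d) d<2
      ... | yes _   | yes c≡0 = subst (λ n → ValuationAtMost p (digitFactor (toℕ d) ^ n) 0) (sym c≡0) (valuation-1 pr)
      ... | yes 2≤d | no c≢0 = large (toℕ d) (c d) {λ m → ValuationAtMost p m 0} 2≤d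
                        (subst (ValuationAtMost p (toℕ d ^ c d)) (ℕ.*-zeroʳ (c d))
                          (valuation-^ pr (c d) (valuation-∤ λ p∣d → p∤b (support d 2≤d c≢0 p pr p∣d))))

  numbers : ℕ → (Fin b → ℕ) → List ℕ
  numbers s c = map (fromDigits ∘ padded s) (words (∑ c) c)

  -- Injectivity is required only on members of the list, because `fromDigits-injective` compares
  -- expansions of equal length.
  map-unique : ∀ {A B : Set} (f : A → B) {xs} → (∀ {x y} → x ∈ xs → y ∈ xs → f x ≡ f y → x ≡ y) →
               Unique xs → Unique (map f xs)
  map-unique f inj [] = []
  map-unique f inj (x∉ ∷ xs!) =
    All.map⁺ (All.tabulate λ y∈ fx≡fy → All.lookup x∉ y∈ (inj (here refl) (there y∈) fx≡fy))
    ∷ map-unique f (λ x∈ y∈ → inj (there x∈) (there y∈)) xs!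

  numbers-unique : ∀ s c → Unique (numbers s c)
  numbers-unique s c = map-unique (fromDigits ∘ padded s) inj (words-unique (∑ c) c)
    where
    inj : ∀ {v w} → v ∈ words (∑ c) c → w ∈ words (∑ c) c → fromDigits (padded s v) ≡ fromDigits (padded s w) → v ≡ w
    inj {v} {w} v∈ w∈ eq = padded-injective s (fromDigits-injective _ _ (begin
      length (padded s v)   ≡⟨ length-padded s v ⟩
      s + suc (length v)    ≡⟨ cong (λ l → s + suc l) (trans (words-length (∑ c) c v∈) (sym (words-length (∑ c) c w∈))) ⟩
      s + suc (length w)    ≡⟨ length-padded s w ⟨
      length (padded s w)   ∎) eq)
      where open ≡-Reasoning

  numbers-count : ∀ s c → ∑ c ! ≤ length (numbers s c) * ∏ (λ d → c d !)
  numbers-count s c = ℕ.≤-trans (n!≤words*∏! (∑ c) c refl)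
    (ℕ.≤-reflexive (cong (_* ∏ (λ d → c d !)) (sym (List.length-map (fromDigits ∘ padded s) (words (∑ c) c)))))

  ∈-numbers : ∀ s c 2≤b {n} → ∏ (λ d → digitFactor (toℕ d) ^ c d) ∣ b ^ s → n ∈ numbers s c →
              1 ≤ n × n < b ^ (s + suc (∑ c)) × nonzeroDigitProduct b 2≤b n ∣ n
  ∈-numbers s c 2≤b ∏∣b^s n∈ with w , w∈ , refl ← ∈.∈-map⁻ (fromDigits ∘ padded s) n∈ =
    1≤padded s w ,
    subst (fromDigits (padded s w) <_) (cong (b ^_) (trans (length-padded s w) (cong (λ l → s + suc l) (words-length (∑ c) c w∈))))
      (fromDigits<b^length (padded s w)) ,
    ∣-trans (∣-reflexive (trans (nonzeroDigitProduct-fromDigits 2≤b (padded s w)) (digitProduct-padded s w)))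
      (∣-trans (words-product (digitFactor ∘ toℕ) (∑ c) c w∈) (∣-trans ∏∣b^s (b^s∣padded s w)))

-- Cardinalities of finite sets of naturals

module Cardinality where
  open import Data.Nat.Base

  -- Delete the head of `ys` from `xs`; by uniqueness the tail of `ys` is still contained in what
  -- remains.
  unique-⊆⇒length≤ : ∀ {A : Set} {xs ys : List A} → Unique ys → (∀ {y} → y ∈ ys → y ∈ xs) → length ys ≤ length xs
  unique-⊆⇒length≤ [] _ = z≤n
  unique-⊆⇒length≤ {ys = y ∷ ys} (y∉ ∷ ys!) ys⊆xs with as , bs , refl ← ∈.∈-∃++ (ys⊆xs (here refl)) = begin
    suc (length ys)                ≤⟨ s≤s (unique-⊆⇒length≤ ys! ys⊆as++bs) ⟩
    suc (length (as ++ bs))        ≡⟨ cong suc (List.length-++ as) ⟩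
    suc (length as + length bs)    ≡⟨ ℕ.+-suc (length as) (length bs) ⟨
    length as + suc (length bs)    ≡⟨ List.length-++ as ⟨
    length (as ++ y ∷ bs)          ∎
    where
    open ℕ.≤-Reasoning
    ys⊆as++bs : ∀ {z} → z ∈ ys → z ∈ as ++ bs
    ys⊆as++bs z∈ys with ∈.∈-++⁻ as (ys⊆xs (there z∈ys))
    ... | inj₁ z∈as          = ∈.∈-++⁺ˡ z∈as
    ... | inj₂ (here refl)   = contradiction refl (All.lookup y∉ z∈ys)
    ... | inj₂ (there z∈bs)  = ∈.∈-++⁺ʳ as z∈bs

  cardinality-≥ : ∀ {S k ys} → S HasCardinality k → Unique ys → (∀ {y} → y ∈ ys → S y) → length ys ≤ k
  cardinality-≥ (xs , _ , refl , ∈⇔S) ys! ys⊆S = unique-⊆⇒length≤ ys! λ y∈ys → Equivalence.from (∈⇔S _) (ys⊆S y∈ys)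

  bounded⇒finite : ExcludedMiddle 0ℓ → ∀ {S : Pred ℕ 0ℓ} M → (∀ n → S n → n < M) → ∃ (S HasCardinality_)
  bounded⇒finite em {S} M S<M = length xs , xs , Unique.filter⁺ S? (Unique.upTo⁺ M) , refl , λ n →
    mk⇔ (proj₂ ∘ ∈.∈-filter⁻ S? {xs = upTo M}) (λ n∈S → ∈.∈-filter⁺ S? (∈.∈-upTo⁺ (S<M n n∈S)) n∈S)
    where
    S? : ∀ n → Dec (S n)
    S? n = em
    xs = filter S? (upTo M)

-- From a bound for every δ to one vanishing ε

module Eventual (em : ExcludedMiddle 0ℓ) (F : CompleteOrderedField) where
  open RealAnalysis F
  open OrderedField em F

  1/x<δ : ∀ {δ} → 0# < δ → ∀ {x} → 1# + δ ⁻¹ ≤ x → x ⁻¹ < δ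
  1/x<δ {δ} 0<δ {x} 1+δ⁻¹≤x = *-cancelˡ-< 0<x (begin-strict
    x * x ⁻¹        ≡⟨ x*x⁻¹≡1 0<x ⟩
    1#              ≡⟨ x*x⁻¹≡1 0<δ ⟨
    δ * δ ⁻¹        <⟨ *-monoˡ-< 0<δ (<-≤-trans (<-by 0<1 (solve 1 (λ i → :1 := :1 :+ i :- i) refl (δ ⁻¹))) 1+δ⁻¹≤x) ⟩
    δ * x           ≡⟨ *-comm δ x ⟩
    x * δ           ∎)
    where
    open ≤-Reasoning
    0<x : 0# < x
    0<x = <-≤-trans (0<1 <⊹ <⇒≤ (0<x⁻¹ 0<δ)) 1+δ⁻¹≤x

  infixr 6 _⊔_
  _⊔_ : ℝ → ℝ → ℝ
  x ⊔ y with total x y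
  ... | inj₁ _ = y
  ... | inj₂ _ = x

  x≤x⊔y : ∀ x y → x ≤ x ⊔ y
  x≤x⊔y x y with total x y
  ... | inj₁ x≤y = x≤y
  ... | inj₂ _   = ≤-refl

  y≤x⊔y : ∀ x y → y ≤ x ⊔ y
  y≤x⊔y x y with total x y
  ... | inj₁ _   = ≤-refl
  ... | inj₂ y≤x = y≤x

  half : ∀ {δ} → 0# < δ → ∃ λ η → 0# < η × η + η ≡ δ
  half {δ} 0<δ = δ / 2# , 0<δ ⊠< 0<x⁻¹ 0<2 , trans (solve 1 (λ h → h :+ h := (:1 :+ :1) :* h) refl (δ / 2#)) (x*[y/x]≡y δ 0<2)
    where
    2# = 1# + 1#
    0<2 : 0# < 2#
    0<2 = 0≤1 ⊹< 0<1

  -- ε x is the supremum of the nonpositive admissible exponents, lowered by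
  -- 1/x so that some admissible exponent exceeds it.
  eventually⇒vanishing : ∀ {Q : ℝ → ℝ → Set} →
    (∀ {x d e} → 1# ≤ x → d ≤ e → Q x e → Q x d) →
    (∀ δ → 0# < δ → Eventually λ x → Q x (- δ)) →
    ∃ λ ε → ε ⟶0 × Eventually λ x → Q x (ε x)
  eventually⇒vanishing {Q} Q-down Q-δ = ε , ε⟶0 , x₁ ⊔ 1# , Q-ε
    where
    -- The cap `e ≤ 0#` bounds the set above, so that its supremum is meaningful, and it yields the
    -- upper estimate `ε x < δ`.
    S : ℝ → Pred ℝ 0ℓ
    S x e = e ≤ 0# × Q x e

    ε : ℝ → ℝ
    ε x = ⋁ (S x) - x ⁻¹

    -- From here on -1 belongs to `S x`, so the supremum is taken over a nonempty set.
    x₁ = proj₁ (Q-δ 1# 0<1)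

    -δ≤0 : ∀ {δ} → 0# < δ → - δ ≤ 0#
    -δ≤0 {δ} 0<δ = ≤-by (<⇒≤ 0<δ) (solve 1 (λ δ → δ := :0 :- :- δ) refl δ)

    S-upper : ∀ {x e} → S x e → e ≤ ⋁ (S x)
    S-upper {x} {e} Sxe = ⋁-upper (S x) (e , Sxe) (0# , λ _ → proj₁) e Sxe

    ε⟶0 : ε ⟶0
    -- Half of δ pays for the member `- η` of `S x`, the other half for the correction `1/x`.
    ε⟶0 δ 0<δ with η , 0<η , refl ← half 0<δ = proj₁ (Q-δ η 0<η) ⊔ (1# + η ⁻¹) , λ x x≥ →
      let Sx-η = -δ≤0 0<η , proj₂ (Q-δ η 0<η) x (≤-trans (x≤x⊔y _ _) x≥)
          1/x<η = 1/x<δ 0<η (≤-trans (y≤x⊔y _ _) x≥)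
          0<x⁻¹′ = 0<x⁻¹ (<-≤-trans (0<1 <⊹ <⇒≤ (0<x⁻¹ 0<η)) (≤-trans (y≤x⊔y _ _) x≥))
      in <-by (Δ≥0 (S-upper Sx-η) ⊹< Δ>0 1/x<η)
           (solve 3 (λ η s i → s :- :- η :+ (η :- i) := s :- i :- :- (η :+ η)) refl η (⋁ (S x)) (x ⁻¹))
       , <-by (Δ≥0 (⋁-least (S x) (- η , Sx-η) 0# (λ _ → proj₁)) ⊹ <⇒≤ 0<x⁻¹′ ⊹< (<⇒≤ 0<η ⊹< 0<η))
           (solve 3 (λ η s i → :0 :- s :+ i :+ (η :+ η) := η :+ η :- (s :- i)) refl η (⋁ (S x)) (x ⁻¹))

    Q-ε : ∀ x → x₁ ⊔ 1# ≤ x → Q x (ε x)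
    Q-ε x x≥ with em {∃ λ e → S x e × ε x ≤ e}
    ... | yes (e , (_ , Qxe) , εx≤e) = Q-down (≤-trans (y≤x⊔y _ _) x≥) εx≤e Qxe
    ... | no  none = contradiction
            (⋁-least (S x) (- 1# , -δ≤0 0<1 , proj₂ (Q-δ 1# 0<1) x (≤-trans (x≤x⊔y _ _) x≥)) (ε x)
              (λ e Sxe → <⇒≤ (≰⇒> λ εx≤e → none (e , Sxe , εx≤e))))
            (<⇒≱ (<-by (0<x⁻¹ (<-≤-trans 0<1 (≤-trans (y≤x⊔y _ _) x≥)))
              (solve 2 (λ s i → i := s :- (s :- i)) refl (⋁ (S x)) (x ⁻¹))))

-- Finite real sums

module RealSums (em : ExcludedMiddle 0ℓ) (F : CompleteOrderedField) where
  open RealAnalysis F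
  open OrderedField em F
  open ExpLog em F
  open MonoidSum (CommutativeRing.+-commutativeMonoid commutativeRing) public using (∑-distrib-+; sum-cong-≗)
  open SemiringSum semiring public using (*-distribˡ-sum)

  sum-mono-≤ : ∀ {n} {f g : Fin n → ℝ} → (∀ i → f i ≤ g i) → sum f ≤ sum g
  sum-mono-≤ {zero}  f≤g = ≤-refl
  sum-mono-≤ {suc n} f≤g = +-mono-≤ (f≤g zero) (sum-mono-≤ (f≤g ∘ suc))

  0≤sum : ∀ {n} {f : Fin n → ℝ} → (∀ i → 0# ≤ f i) → 0# ≤ sum f
  0≤sum {zero}  0≤f = ≤-refl
  0≤sum {suc n} 0≤f = 0≤f zero ⊹ 0≤sum (0≤f ∘ suc)

  term≤sum : ∀ {n} {f : Fin n → ℝ} → (∀ i → 0# ≤ f i) → ∀ i → f i ≤ sum f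
  term≤sum {f = f} 0≤f zero    = ≤-by (0≤sum (0≤f ∘ suc)) (solve 2 (λ x y → y := x :+ y :- x) refl (f zero) _)
  term≤sum {f = f} 0≤f (suc i) = ≤-trans (term≤sum (0≤f ∘ suc) i) (≤-by (0≤f zero) (solve 2 (λ x y → x := x :+ y :- y) refl (f zero) _))

  sum-const : ∀ n x → sum {n} (λ _ → x) ≡ fromℕ n * x
  sum-const zero    x = sym (zeroˡ x)
  sum-const (suc n) x = trans (cong (_+_ x) (sum-const n x))
    (solve 2 (λ x n → x :+ n :* x := (:1 :+ n) :* x) refl x (fromℕ n))

  fromℕ-∑ : ∀ {n} (f : Fin n → ℕ) → fromℕ (∑ f) ≡ sum (fromℕ ∘ f)
  fromℕ-∑ {zero}  f = refl
  fromℕ-∑ {suc n} f = trans (fromℕ-+ (f zero) _) (cong (_+_ (fromℕ (f zero))) (fromℕ-∑ (f ∘ suc)))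

  log-∏ : ∀ {n} (f : Fin n → ℕ) → (∀ i → 1 ℕ.≤ f i) → log (fromℕ (∏ f)) ≡ sum (log ∘ fromℕ ∘ f)
  log-∏ {zero}  f 1≤f = trans (cong log (+-identityʳ 1#)) log1≡0
  log-∏ {suc n} f 1≤f = begin
    log (fromℕ (f zero ℕ.* ∏ (f ∘ suc)))              ≡⟨ cong log (fromℕ-* (f zero) _) ⟩
    log (fromℕ (f zero) * fromℕ (∏ (f ∘ suc)))        ≡⟨ log-* (0<fromℕ (1≤f zero)) (0<fromℕ (1≤∏ (1≤f ∘ suc))) ⟩
    log (fromℕ (f zero)) + log (fromℕ (∏ (f ∘ suc)))  ≡⟨ cong (_+_ (log (fromℕ (f zero)))) (log-∏ (f ∘ suc) (1≤f ∘ suc)) ⟩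
    sum (log ∘ fromℕ ∘ f)                             ∎
    where open ≡-Reasoning

-- Counting the constructed numbers for an admissible α

module Construction (em : ExcludedMiddle 0ℓ) (F : CompleteOrderedField) (b₋₃ : ℕ) where
  open RealAnalysis F
  open OrderedField em F
  open ExpLog em F
  open Factorials em F
  open RealSums em F
  open Eventual em F
  open Digits (suc b₋₃)
  open Words {b}

  lb : ℝ
  lb = log (fromℕ b)

  0<lb : 0# < lb
  0<lb = 0<log (subst (_< fromℕ b) (+-identityʳ 1#) (fromℕ-mono-< {1} {b} (ℕ.s≤s (ℕ.s≤s ℕ.z≤n))))

  module DigitCounts (α : Fin b → ℝ) (α-admissible : Admissible b α) (s : ℕ)
    (c : Fin b → ℕ) (c≤a : ∀ d → fromℕ (c d) ≤ fromℕ s * α d) (a<1+c : ∀ d → fromℕ s * α d < fromℕ (suc (c d))) where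
    open Admissible α-admissible

    a : Fin b → ℝ
    a d = fromℕ s * α d

    0≤a : ∀ d → 0# ≤ a d
    0≤a d = 0≤fromℕ s ⊠ nonneg d

    A : ℝ
    A = fromℕ s * sum α

    sum-a≡A : sum a ≡ A
    sum-a≡A = sym (*-distribˡ-sum (fromℕ s) α)

    0≤A : 0# ≤ A
    0≤A = 0≤fromℕ s ⊠ 0≤sum nonneg

    ∑c≤A : fromℕ (∑ c) ≤ A
    ∑c≤A = ≤-trans (≤-reflexive (fromℕ-∑ c)) (≤-trans (sum-mono-≤ c≤a) (≤-reflexive sum-a≡A))

    -- Each of the `b` roundings loses less than 1. This `b` becomes the parameter `m` of
    -- `log!-lower`.
    A-b≤∑c : A - fromℕ b ≤ fromℕ (∑ c)
    A-b≤∑c = ≤-by (Δ≥0 (begin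
      A                                       ≡⟨ sum-a≡A ⟨
      sum a                                   ≤⟨ sum-mono-≤ (λ d → <⇒≤ (a<1+c d)) ⟩
      sum (λ d → 1# + fromℕ (c d))            ≡⟨ ∑-distrib-+ (λ _ → 1#) (fromℕ ∘ c) ⟩
      sum {b} (λ _ → 1#) + sum (fromℕ ∘ c)    ≡⟨ cong₂ _+_ (sum-const b 1#) (sym (fromℕ-∑ c)) ⟩
      fromℕ b * 1# + fromℕ (∑ c)              ∎))
      (solve 3 (λ b n A → b :* :1 :+ n :- A := n :- (A :- b)) refl (fromℕ b) (fromℕ (∑ c)) A)
      where open ≤-Reasoning

    c-support : ∀ d → 2 ℕ.≤ toℕ d → c d ≢ 0 → ∀ p → Prime p → p ∣ toℕ d → p ∣ b
    c-support d 2≤d c≢0 p pr p∣d with p ∣? b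
    ... | yes p∣b = p∣b
    ... | no  p∤b = contradiction (ℕ.n≤0⇒n≡0 (fromℕ-cancel-≤ (≤-trans (c≤a d) (≤-reflexive
            (trans (cong (_*_ (fromℕ s)) (vanishing d 2≤d (p , pr , p∣d , p∤b))) (zeroʳ (fromℕ s))))))) c≢0

    -- The valuation condition on α multiplied by `s`; rounding down can only decrease the left
    -- side.
    c-valuation : ∀ p → Prime p → p ∣ b → restrictedSum c p ℕ.≤ s
    c-valuation p pr p∣b = fromℕ-cancel-≤ (begin
      fromℕ (restrictedSum c p)
        ≡⟨ fromℕ-∑ (λ d → if does (2 ℕ.≤? toℕ d) then c d ℕ.* ν p (toℕ d) else 0) ⟩
      sum (λ d → fromℕ (if does (2 ℕ.≤? toℕ d) then c d ℕ.* ν p (toℕ d) else 0))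
        ≤⟨ sum-mono-≤ (λ d → if-≤ (does (2 ℕ.≤? toℕ d)) (c d ℕ.* ν p (toℕ d)) (term≤ d)) ⟩
      sum (λ d → fromℕ s * (if does (2 ℕ.≤? toℕ d) then α d * fromℕ (ν p (toℕ d)) else 0#))
        ≡⟨ *-distribˡ-sum (fromℕ s) (λ d → if does (2 ℕ.≤? toℕ d) then α d * fromℕ (ν p (toℕ d)) else 0#) ⟨
      fromℕ s * sum (λ d → if does (2 ℕ.≤? toℕ d) then α d * fromℕ (ν p (toℕ d)) else 0#)
        ≤⟨ *-monoˡ-≤ (0≤fromℕ s) (valuation p pr p∣b) ⟩
      fromℕ s * 1#
        ≡⟨ *-identityʳ (fromℕ s) ⟩
      fromℕ s ∎)
      where
      open ≤-Reasoning
      term≤ : ∀ d → fromℕ (c d ℕ.* ν p (toℕ d)) ≤ fromℕ s * (α d * fromℕ (ν p (toℕ d)))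
      term≤ d = ≤-trans (≤-reflexive (fromℕ-* (c d) (ν p (toℕ d)))) (≤-trans (*-monoʳ-≤ (0≤fromℕ (ν p (toℕ d))) (c≤a d)) (≤-reflexive (*-assoc _ _ _)))
      if-≤ : ∀ t m {x} → fromℕ m ≤ fromℕ s * x → fromℕ (if t then m else 0) ≤ fromℕ s * (if t then x else 0#)
      if-≤ true  m m≤sx = m≤sx
      if-≤ false m _    = ≤-reflexive (sym (zeroʳ (fromℕ s)))

    W : ℕ
    W = length (numbers s c)

    1≤W : 1 ℕ.≤ W
    1≤W with W | numbers-count s c
    ... | zero  | N!≤0 = contradiction (ℕ.≤-trans (ℕ.1≤n! (∑ c)) N!≤0) λ ()
    ... | suc _ | _    = ℕ.s≤s ℕ.z≤n

    log!∑c≤ : log! (∑ c) ≤ log (fromℕ W) + sum (log! ∘ c)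
    log!∑c≤ = begin
      log! (∑ c)                                        ≤⟨ log-mono-≤ (0<fromℕ! (∑ c)) (fromℕ-mono-≤ (numbers-count s c)) ⟩
      log (fromℕ (W ℕ.* ∏ (λ d → c d ℕ.!)))             ≡⟨ cong log (fromℕ-* W _) ⟩
      log (fromℕ W * fromℕ (∏ (λ d → c d ℕ.!)))         ≡⟨ log-* (0<fromℕ {W} 1≤W) (0<fromℕ {∏ (λ d → c d ℕ.!)} (1≤∏ {f = λ d → c d ℕ.!} (ℕ.1≤n! ∘ c))) ⟩
      log (fromℕ W) + log (fromℕ (∏ (λ d → c d ℕ.!)))   ≡⟨ cong (_+_ (log (fromℕ W))) (log-∏ (λ d → c d ℕ.!) (ℕ.1≤n! ∘ c)) ⟩
      log (fromℕ W) + sum (log! ∘ c)                    ∎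
      where open ≤-Reasoning

    sum-log!c≤ : sum (log! ∘ c) ≤ sum (xlogx ∘ a) - A + fromℕ b * (log (1# + A) + (1# + 1#))
    sum-log!c≤ = begin
      sum (log! ∘ c)
        ≤⟨ sum-mono-≤ (λ d → ≤-trans (log!-upper {a d} {c d} (c≤a d) (a<1+c d)) (≤-by (Δ≥0 (log[1+a]≤ d))
             (solve 5 (λ x a l L k → L :- l := x :+ (:0 :- :1) :* a :+ (L :+ k) :- (x :- a :+ l :+ k))
               refl (xlogx (a d)) (a d) (log (1# + a d)) (log (1# + A)) (1# + 1#)))) ⟩
      -- Negation is written as multiplication by `0# - 1#` so that distributivity can pull it out
      -- of the sum.
      sum (λ d → xlogx (a d) + (0# - 1#) * a d + K)
        ≡⟨ ∑-distrib-+ (λ d → xlogx (a d) + (0# - 1#) * a d) (λ _ → K) ⟩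
      sum (λ d → xlogx (a d) + (0# - 1#) * a d) + sum {b} (λ _ → K)
        ≡⟨ cong₂ _+_ (∑-distrib-+ (xlogx ∘ a) (λ d → (0# - 1#) * a d)) (sum-const b K) ⟩
      sum (xlogx ∘ a) + sum (λ d → (0# - 1#) * a d) + fromℕ b * K
        ≡⟨ cong (λ z → sum (xlogx ∘ a) + z + fromℕ b * K) (trans (sym (*-distribˡ-sum (0# - 1#) a)) (cong (_*_ (0# - 1#)) sum-a≡A)) ⟩
      sum (xlogx ∘ a) + (0# - 1#) * A + fromℕ b * K
        ≡⟨ solve 3 (λ x A y → x :+ (:0 :- :1) :* A :+ y := x :- A :+ y) refl (sum (xlogx ∘ a)) A (fromℕ b * K) ⟩
      sum (xlogx ∘ a) - A + fromℕ b * K ∎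
      where
      open ≤-Reasoning
      K = log (1# + A) + (1# + 1#)
      log[1+a]≤ : ∀ d → log (1# + a d) ≤ log (1# + A)
      log[1+a]≤ d = log-mono-≤ (0<1 <⊹ 0≤a d) (+-monoʳ-≤ 1# (≤-trans (term≤sum 0≤a d) (≤-reflexive sum-a≡A)))

    -- The terms `- A` of the two factorial bounds cancel. The `b` denominators contribute an error
    -- `b log (1 + A) + 2b`, the numerator an error `b log (1 + A) + 1`.
    log-W-lower : 1 ℕ.≤ s → fromℕ s * (xlogx (sum α) - sum (xlogx ∘ α))
                  ≤ log (fromℕ W) + ((fromℕ b + fromℕ b) * log (1# + A) + (fromℕ b + fromℕ b + 1#))
    log-W-lower 1≤s = ≤-by
      (Δ≥0 log!∑c≤ ⊹ Δ≥0 sum-log!c≤ ⊹ Δ≥0 (log!-lower {A} {fromℕ b} {∑ c} 0≤A A-b≤∑c)) (begin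
        (LW + sum (log! ∘ c) - log! (∑ c)) + (sum (xlogx ∘ a) - A + B * (L + (1# + 1#)) - sum (log! ∘ c))
          + (log! (∑ c) - (xlogx A - A - B * L - 1#))
          ≡⟨ solve 8 (λ LW Σ! N! Σx A B L xA →
               (LW :+ Σ! :- N!) :+ (Σx :- A :+ B :* (L :+ (:1 :+ :1)) :- Σ!) :+ (N! :- (xA :- A :- B :* L :- :1))
               := LW :+ ((B :+ B) :* L :+ (B :+ B :+ :1)) :- (xA :- Σx))
             refl LW (sum (log! ∘ c)) (log! (∑ c)) (sum (xlogx ∘ a)) A B L (xlogx A) ⟩
        rhs - (xlogx A - sum (xlogx ∘ a))
          ≡⟨ cong (λ z → rhs - z) entropy-scaled ⟩
        rhs - fromℕ s * (xlogx (sum α) - sum (xlogx ∘ α)) ∎)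
      where
      open ≡-Reasoning
      LW = log (fromℕ W)
      B = fromℕ b
      L = log (1# + A)
      rhs = LW + ((B + B) * L + (B + B + 1#))
      0<s : 0# < fromℕ s
      0<s = 0<fromℕ 1≤s
      entropy-scaled : xlogx A - sum (xlogx ∘ a) ≡ fromℕ s * (xlogx (sum α) - sum (xlogx ∘ α))
      entropy-scaled = begin
        xlogx A - sum (xlogx ∘ a)
          ≡⟨ cong₂ _-_ (xlogx-* 0<s (0≤sum nonneg)) (begin
               sum (xlogx ∘ a)
                 ≡⟨ sum-cong-≗ (λ d → xlogx-* 0<s (nonneg d)) ⟩
               sum (λ d → fromℕ s * log (fromℕ s) * α d + fromℕ s * xlogx (α d))
                 ≡⟨ ∑-distrib-+ (λ d → fromℕ s * log (fromℕ s) * α d) (λ d → fromℕ s * xlogx (α d)) ⟩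
               sum (λ d → fromℕ s * log (fromℕ s) * α d) + sum (λ d → fromℕ s * xlogx (α d))
                 ≡⟨ cong₂ _+_ (*-distribˡ-sum (fromℕ s * log (fromℕ s)) α) (*-distribˡ-sum (fromℕ s) (xlogx ∘ α)) ⟨
               fromℕ s * log (fromℕ s) * sum α + fromℕ s * sum (xlogx ∘ α) ∎) ⟩
        fromℕ s * log (fromℕ s) * sum α + fromℕ s * xlogx (sum α)
          - (fromℕ s * log (fromℕ s) * sum α + fromℕ s * sum (xlogx ∘ α))
          ≡⟨ solve 4 (λ s t x y → t :+ s :* x :- (t :+ s :* y) := s :* (x :- y))
               refl (fromℕ s) (fromℕ s * log (fromℕ s) * sum α) (xlogx (sum α)) (sum (xlogx ∘ α)) ⟩
        fromℕ s * (xlogx (sum α) - sum (xlogx ∘ α)) ∎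

    -- In the size condition, the separate summand `lb` pays for the leading digit 1.
    W≤cardinality : ∀ 2≤b {x k} → 0# < x → fromℕ s * ((1# + sum α) * lb) + lb ≤ log x →
                    𝒩 b 2≤b x HasCardinality k → W ℕ.≤ k
    W≤cardinality 2≤b {x} 0<x fits card = Cardinality.cardinality-≥ card (numbers-unique s c) λ {y} y∈ →
      let 1≤y , y<b^ , ∏∣y = ∈-numbers s c 2≤b (∏digitFactor∣b^s c s c-support c-valuation) y∈
      in 1≤y , ≤-trans (fromℕ-mono-≤ (ℕ.<⇒≤ y<b^)) b^≤x , ∏∣y
      where
      open ≤-Reasoning
      e′ = s ℕ.+ suc (∑ c)
      0<b : 0# < fromℕ b
      0<b = 0<fromℕ-suc (suc (suc b₋₃))
      b^≤x : fromℕ (b ℕ.^ e′) ≤ x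
      b^≤x = begin
        fromℕ (b ℕ.^ e′)                  ≡⟨ fromℕ-^ b e′ ⟩
        fromℕ b ^ℕ e′                     ≡⟨ exp-log (0<^ℕ e′ 0<b) ⟨
        exp (log (fromℕ b ^ℕ e′))         ≡⟨ cong exp (log-^ℕ e′ 0<b) ⟩
        exp (fromℕ e′ * lb)               ≤⟨ exp-mono-≤ (begin
          fromℕ e′ * lb                         ≡⟨ cong (λ z → z * lb) (fromℕ-+ s (suc (∑ c))) ⟩
          (fromℕ s + (1# + fromℕ (∑ c))) * lb   ≤⟨ *-monoʳ-≤ (<⇒≤ 0<lb) (+-monoʳ-≤ (fromℕ s) (+-monoʳ-≤ 1# ∑c≤A)) ⟩
          (fromℕ s + (1# + A)) * lb             ≡⟨ solve 3 (λ s S l → (s :+ (:1 :+ s :* S)) :* l := s :* ((:1 :+ S) :* l) :+ l) refl (fromℕ s) (sum α) lb ⟩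
          fromℕ s * ((1# + sum α) * lb) + lb    ≤⟨ fits ⟩
          log x                                 ∎) ⟩
        exp (log x)                       ≡⟨ exp-log 0<x ⟩
        x                                 ∎

  -- With `H = q R`, `log W` is at least `s q R` up to `O(log s)`, while `r log x` is at most
  -- `r q s + r (q + lb)`. The gap `(R - r) q s` decides.
  ^<cardinality-exponent : ∀ 2≤b {α r} → Admissible b α → 0# ≤ r → r < exponent b α →
    Eventually λ x → ∀ k → 𝒩 b 2≤b x HasCardinality k → x ^ r < fromℕ k
  ^<cardinality-exponent 2≤b {α} {r} adm 0≤r r<R = exp (q * fromℕ (suc M′) + lb) , bound
    where
    open Admissible adm
    q = (1# + sum α) * lb
    0<q : 0# < q
    0<q = (0<1 <⊹ 0≤sum nonneg) ⊠< 0<lb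
    H = xlogx (sum α) - sum (xlogx ∘ α)
    R = exponent b α
    qR≡H : q * R ≡ H
    qR≡H = x*[y/x]≡y H 0<q
    β = fromℕ b + fromℕ b
    C = fromℕ b + fromℕ b + 1#
    -- The addition covers what is lost from `log x`: up to one `q` in rounding `τ` down to `s`, and
    -- `lb` for the leading digit.
    C′ = C + r * (q + lb)
    0<g : 0# < (R - r) * q
    0<g = Δ>0 r<R ⊠< 0<q
    small = log-below-linear C′ (0≤fromℕ b ⊹ 0≤fromℕ b) (0≤sum nonneg) 0<g
    -- The successor ensures `s ≥ 1`, as `log-W-lower` demands.
    M′ = suc (proj₁ small)

    bound : ∀ x → exp (q * fromℕ (suc M′) + lb) ≤ x → ∀ k → 𝒩 b 2≤b x HasCardinality k → x ^ r < fromℕ k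
    bound x x₀≤x k card = begin-strict
      exp (r * log x)        <⟨ exp-mono-< rX<logW ⟩
      exp (log (fromℕ W))    ≡⟨ exp-log (0<fromℕ {W} 1≤W) ⟩
      fromℕ W                ≤⟨ fromℕ-mono-≤ (W≤cardinality 2≤b 0<x fits card) ⟩
      fromℕ k                ∎
      where
      open ≤-Reasoning
      0<x : 0# < x
      0<x = <-≤-trans (0<exp _) x₀≤x
      X≥ : q * fromℕ (suc M′) + lb ≤ log x
      X≥ = exp-cancel-≤ (≤-trans x₀≤x (≤-reflexive (sym (exp-log 0<x))))
      τ = (log x - lb) / q
      M′+1≤τ : fromℕ (suc M′) ≤ τ
      M′+1≤τ = ≤/ 0<q (≤-by (Δ≥0 X≥) (solve 3 (λ X y l → X :- (y :+ l) := X :- l :- y) refl (log x) _ lb))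
      fl = floor (≤-trans (0≤fromℕ (suc M′)) M′+1≤τ)
      s = proj₁ fl
      M′≤s : M′ ℕ.≤ s
      M′≤s = ℕ.s≤s⁻¹ (ℕ.<⇒≤ (fromℕ-cancel-< (≤-<-trans M′+1≤τ (proj₂ (proj₂ fl)))))
      ⌊sα⌋ : ∀ d → ∃ λ n → fromℕ n ≤ fromℕ s * α d × fromℕ s * α d < fromℕ (suc n)
      ⌊sα⌋ d = floor (0≤fromℕ s ⊠ nonneg d)
      open DigitCounts α adm s (proj₁ ∘ ⌊sα⌋) (proj₁ ∘ proj₂ ∘ ⌊sα⌋) (proj₂ ∘ proj₂ ∘ ⌊sα⌋)
      qτ≡ : q * τ ≡ log x - lb
      qτ≡ = x*[y/x]≡y (log x - lb) 0<q
      fits : fromℕ s * q + lb ≤ log x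
      fits = ≤-by (Δ≥0 (≤-trans (*-monoˡ-≤ (<⇒≤ 0<q) (proj₁ (proj₂ fl))) (≤-reflexive qτ≡)))
        (solve 4 (λ X l q s → X :- l :- q :* s := X :- (s :* q :+ l)) refl (log x) lb q (fromℕ s))
      X< : log x - lb < q * fromℕ (suc s)
      X< = subst (_< q * fromℕ (suc s)) qτ≡ (*-monoˡ-< 0<q (proj₂ (proj₂ fl)))
      rX<logW : r * log x < log (fromℕ W)
      rX<logW = <-by
        (0≤r ⊠ Δ≥0 (<⇒≤ X<)
          ⊹ Δ≥0 (subst (λ h → fromℕ s * h ≤ log (fromℕ W) + (β * log (1# + A) + C)) (sym qR≡H)
                  (log-W-lower (ℕ.≤-trans (ℕ.s≤s ℕ.z≤n) M′≤s)))
          ⊹< Δ>0 (proj₂ small s (ℕ.≤-trans (ℕ.n≤1+n _) M′≤s)))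
        (solve 9 (λ r q s l X LW βL C R →
            r :* (q :* (:1 :+ s) :- (X :- l)) :+ (LW :+ (βL :+ C) :- s :* (q :* R))
              :+ ((R :- r) :* q :* s :- (βL :+ (C :+ r :* (q :+ l))))
            := LW :- r :* X)
          refl r q (fromℕ s) lb (log x) (log (fromℕ W)) (β * log (1# + A)) C R)

  1≤cardinality : ∀ 2≤b {x k} → 1# ≤ x → 𝒩 b 2≤b x HasCardinality k → 1 ℕ.≤ k
  1≤cardinality 2≤b {x} 1≤x card = Cardinality.cardinality-≥ {ys = 1 ∷ []} card ([] ∷ []) λ { (here refl) →
    ℕ.≤-refl , ≤-trans (≤-reflexive (+-identityʳ 1#)) 1≤x ,
    ∣-reflexive (nonzeroDigitProduct-fromDigits 2≤b (suc zero ∷ [])) }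

  -- For `x ≥ exp 1#` the logarithm is positive, so `x ^ r` is below 1, while the number 1 always
  -- belongs to the set.
  ^<cardinality-negative : ∀ 2≤b {r} → r < 0# → Eventually λ x → ∀ k → 𝒩 b 2≤b x HasCardinality k → x ^ r < fromℕ k
  ^<cardinality-negative 2≤b {r} r<0 = exp 1# , λ x e≤x k card →
    let 0<x = <-≤-trans (0<exp 1#) e≤x
        1≤log = exp-cancel-≤ (≤-trans e≤x (≤-reflexive (sym (exp-log 0<x))))
        1≤x = ≤-trans (≤-trans (≤-by 0≤1 (solve 1 (λ u → u := :1 :+ u :- :1) refl 1#)) (1+x≤exp 1#)) e≤x
        rX<0 = <-by (Δ>0 r<0 ⊠< <-≤-trans 0<1 1≤log) (solve 2 (λ r X → (:0 :- r) :* X := :0 :- r :* X) refl r (log x))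
    in <-≤-trans (subst (x ^ r <_) exp0≡1 (exp-mono-< rX<0)) (1≤fromℕ {k} (1≤cardinality 2≤b 1≤x card))

  -- Otherwise `r` would bound all admissible exponents and hence their supremum `ρ b`; the choice
  -- `α = 0` shows that there is one.
  nearly-optimal : ∀ {r} → r < ρ b → ∃ λ α → Admissible b α × r < exponent b α
  nearly-optimal {r} r<ρ with em {∃ λ α → Admissible b α × r < exponent b α}
  ... | yes found = found
  ... | no  none  = contradiction
          (⋁-least _ (exponent b (λ _ → 0#) , (λ _ → 0#) , zero-admissible , refl) r
            λ { _ (α , adm , refl) → ≮⇒≥ λ r<R → none (α , adm , r<R) })
          (<⇒≱ r<ρ)
    where
    -- The test and the weights are generalised so that the induction can drop the first index.
    sum-zero : ∀ {n} (t : Fin n → Bool) (y : Fin n → ℝ) → sum (λ d → if t d then 0# * y d else 0#) ≡ 0#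
    sum-zero {zero}  t y = refl
    sum-zero {suc n} t y = trans (cong₂ _+_ (if-zero (t zero)) (sum-zero (t ∘ suc) (y ∘ suc))) (+-identityˡ 0#)
      where
      if-zero : ∀ u → (if u then 0# * y zero else 0#) ≡ 0#
      if-zero true  = zeroˡ (y zero)
      if-zero false = refl
    zero-admissible : Admissible b (λ _ → 0#)
    zero-admissible = record
      { nonneg    = λ _ → ≤-refl
      ; vanishing = λ _ _ _ → refl
      ; valuation = λ p _ _ → ≤-trans (≤-reflexive (sum-zero {b} (λ d → does (2 ℕ.≤? toℕ d)) (λ d → fromℕ (ν p (toℕ d))))) 0≤1
      }

  ^<cardinality : ∀ 2≤b δ → 0# < δ → Eventually λ x → ∀ k → 𝒩 b 2≤b x HasCardinality k → x ^ (ρ b + - δ) < fromℕ k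
  ^<cardinality 2≤b δ 0<δ with ≤-<-connex 0# (ρ b + - δ)
  ... | inj₂ ρ-δ<0 = ^<cardinality-negative 2≤b ρ-δ<0
  ... | inj₁ 0≤ρ-δ with α , adm , r<R ← nearly-optimal (<-by 0<δ (solve 2 (λ ρ δ → δ := ρ :- (ρ :- δ)) refl (ρ b) δ)) =
    ^<cardinality-exponent 2≤b adm 0≤ρ-δ r<R

  cardinality : ∀ 2≤b x → ∃ (𝒩 b 2≤b x HasCardinality_)
  cardinality 2≤b x = let M , x<M = archimedean x in
    Cardinality.bounded⇒finite em M λ { n (_ , n≤x , _) → fromℕ-cancel-< (≤-<-trans n≤x x<M) }

open import Data.Nat.Properties using (<⇒≤)

theorem3p1 : ExcludedMiddle 0ℓ →
    (F : CompleteOrderedField) →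
    let open RealAnalysis F in
    (b : ℕ) (3≤b : 3 ℕ.≤ b) →
    ∃ λ (ε : ℝ → ℝ) →
    ε ⟶0 ×
    Eventually λ x →
    ∃ λ k → 𝒩 b (<⇒≤ 3≤b) x HasCardinality k × x ^ (ρ b + ε x) < fromℕ k
theorem3p1 em F b@(suc (suc (suc b₋₃))) 3≤b@(ℕ.s≤s (ℕ.s≤s (ℕ.s≤s _))) = eventually⇒vanishing
  {Q = λ x e → ∃ λ k → 𝒩 b (<⇒≤ 3≤b) x HasCardinality k × x ^ (ρ b + e) < fromℕ k}
  (λ 1≤x d≤e (k , card , xᵉ<k) → k , card ,
    ≤-<-trans (exp-mono-≤ (*-monoʳ-≤ (0≤log 1≤x) (+-monoʳ-≤ (ρ b) d≤e))) xᵉ<k)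
  (λ δ 0<δ → let x₀ , bound = ^<cardinality (<⇒≤ 3≤b) δ 0<δ in
    -- The bound holds for whatever number is a cardinality of the set; `cardinality` supplies one.
    x₀ , λ x x₀≤x → let k , card = cardinality (<⇒≤ 3≤b) x in k , card , bound x x₀≤x k card)
  where
  open RealAnalysis F
  open OrderedField em F hiding (<⇒≤)
  open ExpLog em F
  open Eventual em F
  open Construction em F b₋₃
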